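{- There is a function $f:\mathbb{N}\rightarrow\mathbb{N}$ such that for every $t\in\mathbb{N}$, every bipartite graph with average degree at least $f(t)$ has either a $K_{t,t}$-subgraph or an induced subgraph of average degree at least $t$ and girth at least $6$.
   Context: All graphs are finite and simple. A $K_{t,t}$-subgraph is a (not necessarily induced) subgraph isomorphic to the complete bipartite graph $K_{t,t}$. The girth of a graph is the length of its shortest cycle (infinite if the graph has no cycle). -}

module Defs where

open import Data.Nat using (ℕ; zero; suc; _*_; _≤_)
open import Data.Nat.ListAction using (sum)
open import Data.Bool using (Bool; true; false; if_then_else_)
open import Data.Fin using (Fin; zero; suc; inject₁; fromℕ)
open import Data.List using (map; allFin)
open import Data.Product using (Σ; _×_)
open import Relation.Binary.PropositionalEquality using (_≡_; _≢_)
open import Function.Definitions using (Injective)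

record Graph : Set where
  field
    n      : ℕ
    adj    : Fin n → Fin n → Bool
    sym    : ∀ u v → adj u v ≡ adj v u
    irrefl : ∀ v → adj v v ≡ false

open Graph public

degree : (G : Graph) → Fin (n G) → ℕ
degree G v = sum (map (λ u → if adj G v u then 1 else 0) (allFin (n G)))

degreeSum : Graph → ℕ
degreeSum G = sum (map (degree G) (allFin (n G)))

-- average degree (2|E| / |V|) is at least d; the graph must be nonempty
-- for its average degree to be defined.
AvgDegreeAtLeast : Graph → ℕ → Set
AvgDegreeAtLeast G d = (1 ≤ n G) × (d * n G ≤ degreeSum G)

Bipartite : Graph → Set
Bipartite G = Σ (Fin (n G) → Bool) λ col →
  ∀ u v → adj G u v ≡ true → col u ≢ col v

HasKtt : Graph → ℕ → Set
HasKtt G t = Σ (Fin t → Fin (n G)) λ a → Σ (Fin t → Fin (n G)) λ b →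
  Injective _≡_ _≡_ a × Injective _≡_ _≡_ b ×
  (∀ i j → a i ≢ b j) × (∀ i j → adj G (a i) (b j) ≡ true)

induced : (G : Graph) {m : ℕ} → (Fin m → Fin (n G)) → Graph
induced G {m} ι = record
  { n = m
  ; adj = λ i j → adj G (ι i) (ι j)
  ; sym = λ i j → sym G (ι i) (ι j)
  ; irrefl = λ i → irrefl G (ι i)
  }

HasCycleOfLength : Graph → ℕ → Set
HasCycleOfLength G L = Σ ℕ λ k → (suc k ≡ L) × (3 ≤ L) ×
  Σ (Fin (suc k) → Fin (n G)) λ c → Injective _≡_ _≡_ c ×
    (∀ (i : Fin k) → adj G (c (inject₁ i)) (c (suc i)) ≡ true) ×
    (adj G (c (fromℕ k)) (c zero) ≡ true)

-- girth at least g: every cycle has length ≥ g (vacuous for forests)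
GirthAtLeast : Graph → ℕ → Set
GirthAtLeast G g = ∀ L → HasCycleOfLength G L → g ≤ L

{-# OPTIONS --safe #-}
module Submission where

open import Defs
open import Data.Bool using (Bool; true; false; if_then_else_)
import Data.Bool as Bool
open import Data.Bool.Properties using (¬-not)
open import Data.Empty using (⊥; ⊥-elim)
open import Data.Fin as Fin using (Fin; zero; suc; inject≤)
open import Data.Fin.Properties using (inject≤-injective)
open import Data.List
  using (List; []; _∷_; map; length; filter; lookup; _++_; allFin; cartesianProductWith)
open import Data.List.Membership.Propositional using (_∈_; _∉_; find; lose)
open import Data.List.Membership.Propositional.Properties
  using (∈-lookup; ∈-filter⁻; ∈-filter⁺; ∈-allFin; ∈-length; ∈-∃++; ∈-++⁺ˡ; ∈-++⁺ʳ; ∈-++⁻;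
         ∈-cartesianProductWith⁺; ∈-AllPairs₂)
open import Data.List.Properties
  using (length-filter; length-tabulate; length-++; map-++; map-tabulate; tabulate-lookup; ≡-dec)
open import Data.List.Relation.Binary.Permutation.Propositional
  using (_↭_; ↭-refl; ↭-sym; ↭-trans; prep; ↭⇒↭ₛ)
open import Data.List.Relation.Binary.Permutation.Propositional.Properties
  using (map⁺; shift; ↭-length; ∈-resp-↭)
import Data.List.Relation.Binary.Permutation.Setoid.Properties as Permˢ
open import Data.List.Relation.Unary.All as All using (All; []; _∷_; all?)
open import Data.List.Relation.Unary.All.Properties using (¬Any⇒All¬)
open import Data.List.Relation.Unary.AllPairs as AllPairs using (AllPairs; []; _∷_)
open import Data.List.Relation.Unary.Any as Any using (here; there)
open import Data.List.Relation.Unary.Unique.Propositional using (Unique)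
open import Data.List.Relation.Unary.Unique.Propositional.Properties using (filter⁺; allFin⁺; ++⁺)
open import Data.Nat
open import Data.Nat.ListAction using (sum)
open import Data.Nat.ListAction.Properties using (sum-↭; sum-++)
open import Data.Nat.Properties
open import Data.Nat.Tactic.RingSolver using (solve-∀)
open import Data.Product using (Σ; ∃; ∃₂; _×_; _,_; proj₁; proj₂)
open import Data.Sum as Sum using (_⊎_; inj₁; inj₂)
open import Function using (_∘_; case_of_)
open import Function.Definitions using (Injective)
open import Relation.Binary.Definitions using (DecidableEquality)
open import Relation.Binary.PropositionalEquality renaming (sym to ≡-sym)
open import Relation.Nullary using (¬_; Dec; yes; no)
open import Relation.Nullary.Decidable using (¬?)
open import Relation.Unary using (Decidable)

-- Passing to a critical subset gives a bipartite graph between A and B in which all A-degrees lie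
-- between 2ℓ and 24ℓ and |B| ≤ 4|A|.  Sampling B with probability about 1/ℓ, k times in
-- succession, yields disjoint parts X₁, …, X_k that are tiny compared with the set A′ of those
-- vertices of A with exactly one neighbour in every part: a family of k-tuples.  In the spirit of
-- Füredi's homogeneity theorem, a positive fraction F of A′ can be chosen so that every short list
-- of coordinates either determines the tuple (a key) or has at least t extensions to every one of
-- its values (rich).  A rich list of t coordinates is a K_{t,t}; single coordinates are rich
-- because the parts are small.  If no list of t coordinates is rich, a greedy choice finds a list R
-- and t coordinates S such that R with one coordinate of S is rich, and R with any two is a key.
-- The tuples that agree on R, restricted to the coordinates S, then induce a C₄-free graph of
-- minimum degree at least t.

-- Sums over lists and counting with duplicate-free lists.

private variable
  Elt Elt′ : Set

∑ : List Elt → (Elt → ℕ) → ℕ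
∑ xs f = sum (map f xs)

∑-mono : (xs : List Elt) {f g : Elt → ℕ} → (∀ {x} → x ∈ xs → f x ≤ g x) → ∑ xs f ≤ ∑ xs g
∑-mono []       f≤g = z≤n
∑-mono (x ∷ xs) f≤g = +-mono-≤ (f≤g (here refl)) (∑-mono xs (f≤g ∘ there))

∑-mono-< : (xs : List Elt) {f g : Elt → ℕ} {x : Elt} → (∀ {x} → x ∈ xs → f x ≤ g x) →
           x ∈ xs → f x < g x → ∑ xs f < ∑ xs g
∑-mono-< (x ∷ xs) f≤g (here refl) lt = +-mono-<-≤ lt (∑-mono xs (f≤g ∘ there))
∑-mono-< (x ∷ xs) f≤g (there x∈)  lt = +-mono-≤-< (f≤g (here refl)) (∑-mono-< xs (f≤g ∘ there) x∈ lt)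

∑-cong : (xs : List Elt) {f g : Elt → ℕ} → (∀ {x} → x ∈ xs → f x ≡ g x) → ∑ xs f ≡ ∑ xs g
∑-cong []       eq = refl
∑-cong (x ∷ xs) eq = cong₂ _+_ (eq (here refl)) (∑-cong xs (eq ∘ there))

∑-+ : (xs : List Elt) (f g : Elt → ℕ) → ∑ xs (λ x → f x + g x) ≡ ∑ xs f + ∑ xs g
∑-+ []       f g = refl
∑-+ (x ∷ xs) f g rewrite ∑-+ xs f g = lemma (f x) (g x) (∑ xs f) (∑ xs g)
  where
  lemma : ∀ a b c d → a + b + (c + d) ≡ a + c + (b + d)
  lemma = solve-∀

∑-* : (xs : List Elt) (c : ℕ) (f : Elt → ℕ) → ∑ xs (λ x → c * f x) ≡ c * ∑ xs f
∑-* []       c f = ≡-sym (*-zeroʳ c)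
∑-* (x ∷ xs) c f rewrite ∑-* xs c f = ≡-sym (*-distribˡ-+ c (f x) (∑ xs f))

∑-const : (xs : List Elt) (c : ℕ) → ∑ xs (λ _ → c) ≡ length xs * c
∑-const []       c = refl
∑-const (x ∷ xs) c = cong (c +_) (∑-const xs c)

∑-const-≤ : (xs : List Elt) {c : ℕ} {f : Elt → ℕ} → (∀ {x} → x ∈ xs → c ≤ f x) → length xs * c ≤ ∑ xs f
∑-const-≤ xs {c} c≤f = ≤-trans (≤-reflexive (≡-sym (∑-const xs c))) (∑-mono xs c≤f)

∑-↭ : {xs ys : List Elt} (f : Elt → ℕ) → xs ↭ ys → ∑ xs f ≡ ∑ ys f
∑-↭ f p = sum-↭ (map⁺ f p)

∑-filter : {P : Elt → Set} (P? : Decidable P) (xs : List Elt) (f : Elt → ℕ) →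
           ∑ xs f ≡ ∑ (filter P? xs) f + ∑ (filter (¬? ∘ P?) xs) f
∑-filter P? []       f = refl
∑-filter P? (x ∷ xs) f with P? x
... | yes _ = trans (cong (f x +_) (∑-filter P? xs f)) (≡-sym (+-assoc (f x) _ _))
... | no  _ = trans (cong (f x +_) (∑-filter P? xs f)) (lemma (f x) (∑ (filter P? xs) f) _)
  where
  lemma : ∀ a b c → a + (b + c) ≡ b + (a + c)
  lemma = solve-∀

length-filter-¬ : {P : Elt → Set} (P? : Decidable P) (xs : List Elt) →
                  length xs ≡ length (filter P? xs) + length (filter (¬? ∘ P?) xs)
length-filter-¬ P? []       = refl
length-filter-¬ P? (x ∷ xs) with P? x
... | yes _ = cong suc (length-filter-¬ P? xs)
... | no  _ = trans (cong suc (length-filter-¬ P? xs)) (≡-sym (+-suc _ _))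

𝟙 : Bool → ℕ
𝟙 b = if b then 1 else 0

Unique-resp-↭ : {xs ys : List Elt} → xs ↭ ys → Unique xs → Unique ys
Unique-resp-↭ {Elt} p = Permˢ.Unique-resp-↭ (setoid Elt) (↭⇒↭ₛ p)

∈⇒↭ : {x : Elt} {xs : List Elt} → x ∈ xs → ∃ λ ys → xs ↭ x ∷ ys
∈⇒↭ x∈ with ∈-∃++ x∈
... | ys , zs , refl = ys ++ zs , shift _ ys zs

lookup-injective : {xs : List Elt} → Unique xs → Injective _≡_ _≡_ (lookup xs)
lookup-injective (x∉ ∷ u) {zero}  {zero}  eq = refl
lookup-injective (x∉ ∷ u) {zero}  {suc j} eq = ⊥-elim (All.lookup x∉ (∈-lookup j) eq)
lookup-injective (x∉ ∷ u) {suc i} {zero}  eq = ⊥-elim (All.lookup x∉ (∈-lookup i) (≡-sym eq))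
lookup-injective (x∉ ∷ u) {suc i} {suc j} eq = cong suc (lookup-injective u eq)

-- Pigeonhole: each image is struck from `ys` once it is used, and injectivity on `xs` keeps the
-- later images in what is left.
length-≤-inj : {xs : List Elt} {ys : List Elt′} (g : Elt → Elt′) → Unique xs →
               (∀ {x} → x ∈ xs → g x ∈ ys) →
               (∀ {x y} → x ∈ xs → y ∈ xs → g x ≡ g y → x ≡ y) → length xs ≤ length ys
length-≤-inj {xs = []}     g _        _  _   = z≤n
length-≤-inj {xs = x ∷ xs} {ys} g (x∉ ∷ u) g∈ inj with ∈⇒↭ (g∈ (here refl))
... | zs , p = subst (length (x ∷ xs) ≤_) (≡-sym (↭-length p))
                 (s≤s (length-≤-inj g u g∈zs (λ x∈ y∈ → inj (there x∈) (there y∈))))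
  where
  g∈zs : ∀ {y} → y ∈ xs → g y ∈ zs
  g∈zs y∈ with ∈-resp-↭ p (g∈ (there y∈))
  ... | here eq   = ⊥-elim (All.lookup x∉ y∈ (≡-sym (inj (there y∈) (here refl) eq)))
  ... | there gy∈ = gy∈

nonempty-∈ : {xs : List Elt} → 1 ≤ length xs → ∃ (_∈ xs)
nonempty-∈ {xs = x ∷ _} _ = x , here refl

-- Critical subsets

module Degrees (G : Graph) where

  V : Set
  V = Fin (n G)

  deg : List V → V → ℕ
  deg X v = ∑ X (λ u → 𝟙 (adj G v u))

  -- Twice the number of edges inside a duplicate-free `H`, each edge being counted from both ends.
  e₂ : List V → ℕ
  e₂ H = ∑ H (deg H)

  𝟙≤1 : ∀ b → 𝟙 b ≤ 1
  𝟙≤1 true  = ≤-refl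
  𝟙≤1 false = z≤n

  deg≤length : ∀ X v → deg X v ≤ length X
  deg≤length []      v = z≤n
  deg≤length (u ∷ X) v = +-mono-≤ (𝟙≤1 (adj G v u)) (deg≤length X v)

  e₂-↭ : ∀ {H K} → H ↭ K → e₂ H ≡ e₂ K
  e₂-↭ {H} {K} p = trans (∑-↭ (deg H) p) (∑-cong K (λ _ → ∑-↭ _ p))

  e₂-∷ : ∀ v H → e₂ (v ∷ H) ≡ e₂ H + 2 * deg H v
  e₂-∷ v H rewrite irrefl G v = begin
    deg H v + ∑ H (λ w → 𝟙 (adj G w v) + deg H w) ≡⟨ cong (deg H v +_) (∑-+ H _ _) ⟩
    deg H v + (∑ H (λ w → 𝟙 (adj G w v)) + e₂ H)
      ≡⟨ cong (λ s → deg H v + (s + e₂ H)) (∑-cong H λ {w} _ → cong 𝟙 (Graph.sym G w v)) ⟩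
    deg H v + (deg H v + e₂ H)                    ≡⟨ lemma (deg H v) (e₂ H) ⟩
    e₂ H + 2 * deg H v                            ∎
    where
    open ≡-Reasoning
    lemma : ∀ a b → a + (a + b) ≡ b + 2 * a
    lemma = solve-∀

  -- The field `critical` expresses that deleting any `v` would violate `dense`; it is written with
  -- sums because subtraction on ℕ truncates.
  record Critical (D : ℕ) (H : List V) : Set where
    field
      unique   : Unique H
      nonempty : 1 ≤ length H
      dense    : D * length H ≤ e₂ H
      critical : ∀ {v} → v ∈ H → e₂ H + D < D * length H + 2 * deg H v

  -- As long as some vertex can be deleted without destroying density, it is deleted; the length
  -- drops each time, so the process stops.
  critical-subset : ∀ {D} m H → 1 ≤ D → length H ≡ suc m → Unique H → D * suc m ≤ e₂ H →
                    ∃ (Critical D)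
  critical-subset {D} m H 1≤D |H| u dense
    with Any.any? (λ v → D * length H + 2 * deg H v ≤? e₂ H + D) H
  ... | no none = H , record
    { unique = u
    ; nonempty = subst (1 ≤_) (≡-sym |H|) (s≤s z≤n)
    ; dense = subst (λ k → D * k ≤ e₂ H) (≡-sym |H|) dense
    ; critical = λ v∈ → ≰⇒> (All.lookup (¬Any⇒All¬ H none) v∈)
    }
  ... | yes some with find some
  ... | v , v∈ , removable with ∈⇒↭ v∈
  ... | H′ , p = recurse m H′ (suc-injective (trans (≡-sym (↭-length p)) |H|))
    (AllPairs.tail (Unique-resp-↭ p u)) dense′ (trans (e₂-↭ p) (e₂-∷ v H′))
    where
    degH : deg H v ≡ deg H′ v
    degH = trans (∑-↭ _ p) (cong (λ b → 𝟙 b + deg H′ v) (irrefl G v))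

    dense′ : D * length H′ ≤ e₂ H′
    dense′ = +-cancelʳ-≤ (D + 2 * deg H′ v) _ _ (begin
      D * length H′ + (D + 2 * deg H′ v)  ≡⟨ lemma D (length H′) (2 * deg H′ v) ⟩
      D * suc (length H′) + 2 * deg H′ v  ≡⟨ cong₂ (λ a b → D * a + 2 * b) (≡-sym (↭-length p)) (≡-sym degH) ⟩
      D * length H + 2 * deg H v          ≤⟨ removable ⟩
      e₂ H + D                            ≡⟨ cong (_+ D) (trans (e₂-↭ p) (e₂-∷ v H′)) ⟩
      e₂ H′ + 2 * deg H′ v + D            ≡⟨ trans (+-assoc (e₂ H′) _ D) (cong (e₂ H′ +_) (+-comm _ D)) ⟩
      e₂ H′ + (D + 2 * deg H′ v)          ∎)
      where
      open ≤-Reasoning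
      lemma : ∀ D a b → D * a + (D + b) ≡ D * suc a + b
      lemma = solve-∀

    recurse : ∀ m H′ → length H′ ≡ m → Unique H′ → D * length H′ ≤ e₂ H′ →
              e₂ H ≡ e₂ H′ + 2 * deg H′ v → ∃ (Critical D)
    recurse (suc m) H′ |H′| u′ d _ = critical-subset m H′ 1≤D |H′| u′ (subst (λ k → D * k ≤ e₂ H′) |H′| d)
    -- Here `H` is a single vertex, which spans no edge and so contradicts `dense`: the deletion
    -- never empties the list.
    recurse zero    []  _   _ _ e₂H = ⊥-elim (<⇒≱ (≤-trans 1≤D (m≤m*n D (suc m))) (subst (D * suc m ≤_) e₂H dense))

  -- Markov's inequality: if more than half of `A` had values above `2 * k`, the sum would exceed
  -- `k * length A`.
  sparse-half : ∀ (A : List V) (f : V → ℕ) {k} → ∑ A f ≤ k * length A → 0 < k →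
                length A ≤ 2 * length (filter (λ v → f v ≤? 2 * k) A)
  sparse-half A f {k} ∑≤ 0<k = +-cancelʳ-≤ (length A) _ _ (begin
    length A + length A      ≡⟨ cong (λ x → x + x) (length-filter-¬ P? A) ⟩
    s + l + (s + l)          ≡⟨ lemma s l ⟩
    2 * s + 2 * l            ≤⟨ +-monoʳ-≤ (2 * s) (*-cancelˡ-≤ k {{>-nonZero 0<k}} few) ⟩
    2 * s + length A         ∎)
    where
    open ≤-Reasoning
    P? = λ v → f v ≤? 2 * k
    s = length (filter P? A)
    l = length (filter (¬? ∘ P?) A)
    lemma : ∀ s l → s + l + (s + l) ≡ 2 * s + 2 * l
    lemma = solve-∀
    lemma′ : ∀ k l → k * (2 * l) ≡ l * (2 * k)
    lemma′ = solve-∀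
    few : k * (2 * l) ≤ k * length A
    few = begin
      k * (2 * l)                 ≡⟨ lemma′ k l ⟩
      l * (2 * k)                 ≤⟨ ∑-const-≤ (filter (¬? ∘ P?) A)
                                       (λ v∈ → ≰⇒≥ (proj₂ (∈-filter⁻ (¬? ∘ P?) {xs = A} v∈))) ⟩
      ∑ (filter (¬? ∘ P?) A) f    ≤⟨ m≤n+m _ _ ⟩
      ∑ (filter P? A) f + ∑ (filter (¬? ∘ P?) A) f ≡⟨ ≡-sym (∑-filter P? A f) ⟩
      ∑ A f                       ≤⟨ ∑≤ ⟩
      k * length A                ∎

  module _ (col : V → Bool) (proper : ∀ u v → adj G u v ≡ true → col u ≢ col v) where

    record Sides (ℓ : ℕ) : Set where
      field
        c        : Bool
        A B      : List V
        uniqueA  : Unique A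
        uniqueB  : Unique B
        colA     : ∀ {a} → a ∈ A → col a ≡ c
        colB     : ∀ {b} → b ∈ B → col b ≢ c
        nonempty : 1 ≤ length A
        small    : length B ≤ 4 * length A
        lower    : ∀ {a} → a ∈ A → 2 * ℓ ≤ deg B a
        upper    : ∀ {a} → a ∈ A → deg B a ≤ 24 * ℓ

    colour : Bool → List V → List V
    colour c = filter (λ v → col v Bool.≟ c)

    length-colours : ∀ H → length H ≡ length (colour true H) + length (colour false H)
    length-colours []      = refl
    length-colours (v ∷ H) with col v
    ... | true  = cong suc (length-colours H)
    ... | false = trans (cong suc (length-colours H)) (≡-sym (+-suc _ _))

    majority : ∀ H → ∃ λ c → length H ≤ 2 * length (colour c H)
    majority H with ≤-total (length (colour true H)) (length (colour false H))
    ... | inj₁ t≤f = false , (begin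
      length H              ≡⟨ length-colours H ⟩
      length (colour true H) + length (colour false H) ≤⟨ +-mono-≤ t≤f (≤-reflexive (≡-sym (+-identityʳ _))) ⟩
      2 * length (colour false H) ∎) where open ≤-Reasoning
    ... | inj₂ f≤t = true , (begin
      length H              ≡⟨ length-colours H ⟩
      length (colour true H) + length (colour false H)
        ≤⟨ +-monoʳ-≤ (length (colour true H)) (≤-trans f≤t (≤-reflexive (≡-sym (+-identityʳ _)))) ⟩
      2 * length (colour true H)  ∎) where open ≤-Reasoning

    -- The larger colour class `A` has at least half of `H`, and its low-degree part `A′` at least
    -- half of `A`; hence the 4 in `small`. The average degree of `H` is at most 6ℓ, that over `A`
    -- at most 12ℓ, and the cut is made at twice this.
    critical⇒sides : ∀ {ℓ H} → 1 ≤ ℓ → Critical (4 * ℓ) H → Sides ℓ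
    critical⇒sides {ℓ} {H} 1≤ℓ K = record
      { c = c ; A = A′ ; B = B
      ; uniqueA = filter⁺ _ (filter⁺ _ unique)
      ; uniqueB = filter⁺ _ unique
      ; colA = λ a∈ → proj₂ (∈-filter⁻ _ {xs = H} (proj₁ (∈-filter⁻ _ {xs = A} a∈)))
      ; colB = λ b∈ → proj₂ (∈-filter⁻ _ {xs = H} b∈)
      ; nonempty = pos (≤-trans (≤-trans nonempty |H|≤) (*-monoʳ-≤ 2 |A|≤))
      ; small = ≤-trans (length-filter _ H) (≤-trans |H|≤ (≤-trans (*-monoʳ-≤ 2 |A|≤)
                  (≤-reflexive (≡-sym (*-assoc 2 2 (length A′))))))
      ; lower = λ a∈ → let a∈A = proj₁ (∈-filter⁻ _ {xs = A} a∈) in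
          subst (2 * ℓ ≤_) (degB a∈A) (lower (proj₁ (∈-filter⁻ _ {xs = H} a∈A)))
      ; upper = λ a∈ → let (a∈A , d≤) = ∈-filter⁻ (λ v → deg H v ≤? 2 * (12 * ℓ)) {xs = A} a∈ in
          subst (_≤ 24 * ℓ) (degB a∈A) (≤-trans d≤ (≤-reflexive (≡-sym (*-assoc 2 12 ℓ))))
      }
      where
      open Critical K
      open ≤-Reasoning
      c = proj₁ (majority H)
      |H|≤ : length H ≤ 2 * length (colour c H)
      |H|≤ = proj₂ (majority H)
      A = colour c H
      B = filter (¬? ∘ (λ v → col v Bool.≟ c)) H
      A′ = filter (λ v → deg H v ≤? 2 * (12 * ℓ)) A

      pos : ∀ {m} → 1 ≤ 2 * (2 * m) → 1 ≤ m
      pos {suc m} _ = s≤s z≤n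

      degB : ∀ {a} → a ∈ A → deg H a ≡ deg B a
      degB {a} a∈ = trans (∑-filter (λ v → col v Bool.≟ c) H _) (cong (_+ deg B a)
        (trans (∑-cong A nonadj) (trans (∑-const A 0) (*-zeroʳ (length A)))))
        where
        nonadj : ∀ {v} → v ∈ A → 𝟙 (adj G a v) ≡ 0
        nonadj {v} v∈ with adj G a v in eq
        ... | false = refl
        ... | true  = ⊥-elim (proper a v eq (trans (proj₂ (∈-filter⁻ _ {xs = H} a∈))
                                                 (≡-sym (proj₂ (∈-filter⁻ _ {xs = H} v∈)))))

      -- Comparing `dense` with `critical` shows that every vertex has at least half of the average
      -- degree `4 * ℓ`.
      lower : ∀ {v} → v ∈ H → 2 * ℓ ≤ deg H v
      lower {v} v∈ = *-cancelˡ-≤ 2 (+-cancelˡ-≤ (4 * ℓ * length H) _ _ (begin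
        4 * ℓ * length H + 2 * (2 * ℓ)  ≡⟨ cong (4 * ℓ * length H +_) (≡-sym (*-assoc 2 2 ℓ)) ⟩
        4 * ℓ * length H + 4 * ℓ        ≤⟨ +-monoˡ-≤ (4 * ℓ) dense ⟩
        e₂ H + 4 * ℓ                    ≤⟨ <⇒≤ (critical v∈) ⟩
        4 * ℓ * length H + 2 * deg H v  ∎))

      -- Criticality at a single vertex also bounds `e₂ H` from above, because the degree of that
      -- vertex is at most `length H`.
      total : e₂ H ≤ 6 * ℓ * length H
      total with nonempty-∈ nonempty
      ... | v , v∈ = begin
        e₂ H                             ≤⟨ ≤-trans (m≤m+n (e₂ H) (4 * ℓ)) (<⇒≤ (critical v∈)) ⟩
        4 * ℓ * length H + 2 * deg H v   ≤⟨ +-monoʳ-≤ (4 * ℓ * length H) (*-mono-≤ (*-monoʳ-≤ 2 1≤ℓ) (deg≤length H v)) ⟩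
        4 * ℓ * length H + 2 * ℓ * length H ≡⟨ lemma ℓ (length H) ⟩
        6 * ℓ * length H                 ∎
        where
        lemma : ∀ ℓ h → 4 * ℓ * h + 2 * ℓ * h ≡ 6 * ℓ * h
        lemma = solve-∀

      |A|≤ : length A ≤ 2 * length A′
      |A|≤ = sparse-half A (deg H) (begin
        ∑ A (deg H)              ≤⟨ m≤m+n _ _ ⟩
        ∑ A (deg H) + ∑ B (deg H) ≡⟨ ≡-sym (∑-filter (λ v → col v Bool.≟ c) H (deg H)) ⟩
        e₂ H                     ≤⟨ total ⟩
        6 * ℓ * length H         ≤⟨ *-monoʳ-≤ (6 * ℓ) |H|≤ ⟩
        6 * ℓ * (2 * length A)   ≡⟨ lemma ℓ (length A) ⟩
        12 * ℓ * length A        ∎) (≤-trans 1≤ℓ (m≤n*m ℓ 12))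
        where
        lemma : ∀ ℓ h → 6 * ℓ * (2 * h) ≡ 12 * ℓ * h
        lemma = solve-∀

    dense⇒sides : ∀ {ℓ} → 1 ≤ ℓ → AvgDegreeAtLeast G (4 * ℓ) → Sides ℓ
    dense⇒sides {ℓ} 1≤ℓ (1≤n , avg) = critical⇒sides 1≤ℓ (proj₂ core)
      where
      core : ∃ (Critical (4 * ℓ))
      core = critical-subset (pred (n G)) (allFin (n G)) (≤-trans 1≤ℓ (m≤n*m ℓ 4))
        (trans (length-tabulate {n = n G} (λ i → i)) n≡) (allFin⁺ _)
        (subst (λ k → 4 * ℓ * k ≤ degreeSum G) n≡ avg)
        where
        n≡ : n G ≡ suc (pred (n G))
        n≡ = ≡-sym (suc-pred (n G) {{>-nonZero 1≤n}})

-- Random parts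

-- (1 + r)^|B| times the expectation of F at the random sublist of B that contains each entry
-- independently with probability 1 / (1 + r).
𝔼 : ℕ → List Elt′ → (List Elt′ → ℕ) → ℕ
𝔼 r []      F = F []
𝔼 r (b ∷ B) F = 𝔼 r B (F ∘ (b ∷_)) + r * 𝔼 r B F

module _ (r : ℕ) where

  private
    q : ℕ
    q = suc r

  weight : List Elt′ → ℕ
  weight B = q ^ length B

  𝔼-+ : ∀ (B : List Elt′) F G → 𝔼 r B (λ X → F X + G X) ≡ 𝔼 r B F + 𝔼 r B G
  𝔼-+ []      F G = refl
  𝔼-+ (b ∷ B) F G rewrite 𝔼-+ B (F ∘ (b ∷_)) (G ∘ (b ∷_)) | 𝔼-+ B F G =
    lemma (𝔼 r B (F ∘ (b ∷_))) (𝔼 r B (G ∘ (b ∷_))) r (𝔼 r B F) (𝔼 r B G)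
    where
    lemma : ∀ a b r c d → a + b + r * (c + d) ≡ a + r * c + (b + r * d)
    lemma = solve-∀

  𝔼-* : ∀ (B : List Elt′) k F → 𝔼 r B (λ X → k * F X) ≡ k * 𝔼 r B F
  𝔼-* []      k F = refl
  𝔼-* (b ∷ B) k F rewrite 𝔼-* B k (F ∘ (b ∷_)) | 𝔼-* B k F =
    lemma k (𝔼 r B (F ∘ (b ∷_))) r (𝔼 r B F)
    where
    lemma : ∀ k a r b → k * a + r * (k * b) ≡ k * (a + r * b)
    lemma = solve-∀

  𝔼-const : ∀ (B : List Elt′) k → 𝔼 r B (λ _ → k) ≡ k * weight B
  𝔼-const []      k = ≡-sym (*-identityʳ k)
  𝔼-const (b ∷ B) k rewrite 𝔼-const B k = lemma k (weight B) r
    where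
    lemma : ∀ k w r → k * w + r * (k * w) ≡ k * (w + r * w)
    lemma = solve-∀

  𝔼-∑ : ∀ (A : List Elt) (B : List Elt′) (F : Elt → List Elt′ → ℕ) →
        𝔼 r B (λ X → ∑ A (λ a → F a X)) ≡ ∑ A (λ a → 𝔼 r B (F a))
  𝔼-∑ []      B F = 𝔼-const B 0
  𝔼-∑ (a ∷ A) B F = trans (𝔼-+ B (F a) _) (cong (𝔼 r B (F a) +_) (𝔼-∑ A B F))

  -- Linearity of expectation with inclusion probability `1 / q`, denominators cleared.
  𝔼-first-moment : ∀ (B : List Elt′) f → q * 𝔼 r B (λ X → ∑ X f) ≡ weight B * ∑ B f
  𝔼-first-moment []      f = *-zeroʳ q
  𝔼-first-moment (b ∷ B) f
    rewrite 𝔼-+ B (λ _ → f b) (λ X → ∑ X f) | 𝔼-const B (f b) = begin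
    q * (f b * w + e + r * e)           ≡⟨ lemma r (f b) w e ⟩
    q * (f b * w) + q * (q * e)         ≡⟨ cong (λ x → q * (f b * w) + q * x) (𝔼-first-moment B f) ⟩
    q * (f b * w) + q * (w * ∑ B f)     ≡⟨ lemma′ q (f b) w (∑ B f) ⟩
    q * w * (f b + ∑ B f)               ∎
    where
    open ≡-Reasoning
    w = weight B
    e = 𝔼 r B (λ X → ∑ X f)
    lemma : ∀ r f w e → suc r * (f * w + e + r * e) ≡ suc r * (f * w) + suc r * (suc r * e)
    lemma = solve-∀
    lemma′ : ∀ q f w s → q * (f * w) + q * (w * s) ≡ q * w * (f + s)
    lemma′ = solve-∀

  -- With p = 1/q and S = `∑ B f`, the mean of the square is at most pS + p²S²: the diagonal terms
  -- contribute p times the sum of the f², at most pS because f² ≤ f, and the mixed terms at most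
  -- p²S².
  𝔼-second-moment : ∀ (B : List Elt′) f → (∀ b → f b * f b ≤ f b) →
    q * q * 𝔼 r B (λ X → ∑ X f * ∑ X f) ≤ weight B * (q * ∑ B f + ∑ B f * ∑ B f)
  𝔼-second-moment []      f f²≤f = ≤-reflexive (lemma (q * q) q)
    where
    lemma : ∀ a q → a * 0 ≡ 1 * (q * 0 + 0)
    lemma = solve-∀
  𝔼-second-moment (b ∷ B) f f²≤f = begin
    q * q * (𝔼 r B (λ X → (f b + ∑ X f) * (f b + ∑ X f)) + r * e₂)
      ≡⟨ cong (λ x → q * q * (x + r * e₂)) expand ⟩
    q * q * (f b * f b * w + 2 * f b * e₁ + e₂ + r * e₂)
      ≡⟨ lemma r (f b) w e₁ e₂ ⟩
    q * q * (f b * f b) * w + 2 * q * f b * (q * e₁) + q * (q * q * e₂)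
      ≤⟨ +-mono-≤ (+-mono-≤ (*-monoˡ-≤ w (*-monoʳ-≤ (q * q) (f²≤f b)))
                            (≤-reflexive (cong (2 * q * f b *_) (𝔼-first-moment B f))))
                  (*-monoʳ-≤ q (𝔼-second-moment B f f²≤f)) ⟩
    q * q * f b * w + 2 * q * f b * (w * s) + q * (w * (q * s + s * s))
      -- The added diagonal term completes the square of `f b + s`.
      ≤⟨ m≤m+n _ (q * w * (f b * f b)) ⟩
    q * q * f b * w + 2 * q * f b * (w * s) + q * (w * (q * s + s * s)) + q * w * (f b * f b)
      ≡⟨ lemma′ q (f b) w s ⟩
    q * w * (q * (f b + s) + (f b + s) * (f b + s)) ∎
    where
    open ≤-Reasoning
    w = weight B
    s = ∑ B f
    e₁ = 𝔼 r B (λ X → ∑ X f)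
    e₂ = 𝔼 r B (λ X → ∑ X f * ∑ X f)
    lemma : ∀ r f w e₁ e₂ → suc r * suc r * (f * f * w + 2 * f * e₁ + e₂ + r * e₂) ≡
      suc r * suc r * (f * f) * w + 2 * suc r * f * (suc r * e₁) + suc r * (suc r * suc r * e₂)
    lemma = solve-∀
    lemma′ : ∀ q f w s →
      q * q * f * w + 2 * q * f * (w * s) + q * (w * (q * s + s * s)) + q * w * (f * f) ≡
      q * w * (q * (f + s) + (f + s) * (f + s))
    lemma′ = solve-∀
    square : ∀ x y → (x + y) * (x + y) ≡ x * x + 2 * x * y + y * y
    square = solve-∀
    𝔼-cong : ∀ (B : List _) {F G} → (∀ X → F X ≡ G X) → 𝔼 r B F ≡ 𝔼 r B G
    𝔼-cong []      F≡G = F≡G []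
    𝔼-cong (b ∷ B) F≡G = cong₂ (λ x y → x + r * y) (𝔼-cong B (F≡G ∘ (b ∷_))) (𝔼-cong B F≡G)
    expand : 𝔼 r B (λ X → (f b + ∑ X f) * (f b + ∑ X f)) ≡ f b * f b * w + 2 * f b * e₁ + e₂
    expand = trans (𝔼-cong B (λ X → square (f b) (∑ X f)))
      (trans (𝔼-+ B _ _) (cong (_+ e₂) (trans (𝔼-+ B _ _)
        (cong₂ _+_ (𝔼-const B (f b * f b)) (𝔼-* B (2 * f b) (λ X → ∑ X f))))))

  -- First-moment method: if `R` exceeded `L` on every sublist, it would do so in the mean. The
  -- complement `Y` is kept because the next part is drawn from it.
  𝔼-attained : ∀ (B : List Elt′) L R → 𝔼 r B R ≤ 𝔼 r B L → ∃₂ λ X Y → X ++ Y ↭ B × R X ≤ L X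
  𝔼-attained B L R R≤L with attained⊎< B L R
    where
    attained⊎< : ∀ (B : List Elt′) L R → (∃₂ λ X Y → X ++ Y ↭ B × R X ≤ L X) ⊎ 𝔼 r B L < 𝔼 r B R
    attained⊎< []      L R with R [] ≤? L []
    ... | yes R≤L = inj₁ ([] , [] , ↭-refl , R≤L)
    ... | no  R≰L = inj₂ (≰⇒> R≰L)
    attained⊎< (b ∷ B) L R with attained⊎< B (L ∘ (b ∷_)) (R ∘ (b ∷_)) | attained⊎< B L R
    ... | inj₁ (X , Y , p , R≤L) | _ = inj₁ (b ∷ X , Y , prep b p , R≤L)
    ... | inj₂ _ | inj₁ (X , Y , p , R≤L) = inj₁ (X , b ∷ Y , ↭-trans (shift b X Y) (prep b p) , R≤L)
    -- Strictness is taken from the branch containing `b`, whose weight is 1; the other weight `r`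
    -- may be 0.
    ... | inj₂ lt | inj₂ lt′ = inj₂ (+-mono-<-≤ lt (*-monoʳ-≤ r (<⇒≤ lt′)))
  ... | inj₁ found = found
  ... | inj₂ L<R   = ⊥-elim (<⇒≱ L<R R≤L)

-- Sampling a single part.

∑-≤-filter : {P : Elt → Set} (P? : Decidable P) (xs : List Elt) {f g : Elt → ℕ} →
             (∀ {x} → P x → f x ≤ suc (g x)) → (∀ {x} → ¬ P x → f x ≤ g x) →
             ∑ xs f ≤ ∑ xs g + length (filter P? xs)
∑-≤-filter P? []       _   _  = z≤n
∑-≤-filter P? (x ∷ xs) {f} {g} inP outP with P? x
... | yes p = ≤-trans (+-mono-≤ (inP p) (∑-≤-filter P? xs inP outP))
                      (≤-reflexive (lemma (g x) (∑ xs g) (length (filter P? xs))))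
  where
  lemma : ∀ a b c → suc a + (b + c) ≡ a + b + suc c
  lemma = solve-∀
... | no ¬p = ≤-trans (+-mono-≤ (outP ¬p) (∑-≤-filter P? xs inP outP)) (≤-reflexive (≡-sym (+-assoc (g x) _ _)))

module Sampling (G : Graph) where
  open Degrees G

  exactlyOne : List V → List V → List V
  exactlyOne X = filter (λ a → deg X a ≟ 1)

  -- 2 d − d² is positive only for d = 1, which makes its expectation a lower bound for the
  -- probability that a has exactly one neighbour in X.
  2d≤d²+[d=1] : ∀ X A → 2 * ∑ A (deg X) ≤ ∑ A (λ a → deg X a * deg X a) + length (exactlyOne X A)
  2d≤d²+[d=1] X A = ≤-trans (≤-reflexive (≡-sym (∑-* A 2 (deg X))))
    (∑-≤-filter (λ a → deg X a ≟ 1) A (λ {a} → one (deg X a)) (λ {a} → notOne (deg X a)))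
    where
    one : ∀ d → d ≡ 1 → 2 * d ≤ suc (d * d)
    one .1 refl = ≤-refl
    notOne : ∀ d → ¬ d ≡ 1 → 2 * d ≤ d * d
    notOne 0 _ = z≤n
    notOne 1 d≢1 = ⊥-elim (d≢1 refl)
    notOne (suc (suc d)) _ = *-monoˡ-≤ (suc (suc d)) {2} {suc (suc d)} (s≤s (s≤s z≤n))

  -- Let p = `deg B a` / q with q = `suc r`, so that 4/N ≤ p ≤ 1/2. Then 2d - d² has mean at least
  -- 2p - (p + p²) = p(1 - p) ≥ 2/N, and N times the expected length of `exactlyOne X A` is at least
  -- twice that of `A`. One copy of `length A` pays for K times the expected size of `X`, the other
  -- remains.
  sample : ∀ {r N K} A B →
    (∀ {a} → a ∈ A → 2 * deg B a ≤ suc r) →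
    (∀ {a} → a ∈ A → 4 * suc r ≤ N * deg B a) →
    K * length B ≤ suc r * length A →
    ∃₂ λ X Y → X ++ Y ↭ B × K * length X + length A ≤ N * length (exactlyOne X A)
  sample {r} {N} {K} A B up low small =
    let X , Y , p , R≤L = 𝔼-attained r B L R mean in X , Y , p , conclude X R≤L
    where
    open ≤-Reasoning
    q = suc r
    w = weight r B
    α = length A
    m = deg B
    -- `R X ≤ L X` is the desired inequality with the count replaced by its lower bound, the sum of
    -- 2d - d², and the squares moved across. `length X` is written as a sum so that the first
    -- moment applies to it.
    L R : List V → ℕ
    L X = N * (2 * ∑ A (deg X))
    R X = N * ∑ A (λ a → deg X a * deg X a) + (K * ∑ X (λ _ → 1) + α)
    Σm = ∑ A m
    Σm² = ∑ A (λ a → m a * m a)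
    e₁ = ∑ A (λ a → 𝔼 r B (λ X → deg X a))
    e₂′ = ∑ A (λ a → 𝔼 r B (λ X → deg X a * deg X a))
    e₃ = 𝔼 r B (λ X → ∑ X (λ _ → 1))

    𝟙²≤𝟙 : ∀ b → 𝟙 b * 𝟙 b ≤ 𝟙 b
    𝟙²≤𝟙 true  = ≤-refl
    𝟙²≤𝟙 false = z≤n

    e₁≡ : q * e₁ ≡ w * Σm
    e₁≡ = trans (≡-sym (∑-* A q _)) (trans (∑-cong A (λ {a} _ → 𝔼-first-moment r B _)) (∑-* A w m))

    e₂≤ : q * q * e₂′ ≤ w * (q * Σm + Σm²)
    e₂≤ = begin
      q * q * e₂′ ≡⟨ ≡-sym (∑-* A (q * q) _) ⟩
      ∑ A (λ a → q * q * 𝔼 r B (λ X → deg X a * deg X a))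
        ≤⟨ ∑-mono A (λ {a} _ → 𝔼-second-moment r B (λ u → 𝟙 (adj G a u)) (λ u → 𝟙²≤𝟙 (adj G a u))) ⟩
      ∑ A (λ a → w * (q * m a + m a * m a)) ≡⟨ ∑-* A w _ ⟩
      w * ∑ A (λ a → q * m a + m a * m a) ≡⟨ cong (w *_) (trans (∑-+ A _ _) (cong (_+ Σm²) (∑-* A q m))) ⟩
      w * (q * Σm + Σm²) ∎

    e₃≡ : q * e₃ ≡ w * length B
    e₃≡ = trans (𝔼-first-moment r B _) (cong (w *_) (trans (∑-const B 1) (*-identityʳ (length B))))

    -- The bound 2/N ≤ p(1 - p), multiplied by N q².
    pointwise : ∀ {a} → a ∈ A → 2 * (q * q) + N * (m a * m a) ≤ N * q * m a
    pointwise {a} a∈ = *-cancelˡ-≤ 2 (begin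
      2 * (2 * (q * q) + N * (m a * m a))   ≡⟨ lemma q N (m a) ⟩
      4 * q * q + N * m a * (2 * m a)       ≤⟨ +-mono-≤ (*-monoˡ-≤ q (low a∈)) (*-monoʳ-≤ (N * m a) (up a∈)) ⟩
      N * m a * q + N * m a * q             ≡⟨ lemma′ q N (m a) ⟩
      2 * (N * q * m a)                     ∎)
      where
      lemma : ∀ q N m → 2 * (2 * (q * q) + N * (m * m)) ≡ 4 * q * q + N * m * (2 * m)
      lemma = solve-∀
      lemma′ : ∀ q N m → N * m * q + N * m * q ≡ 2 * (N * q * m)
      lemma′ = solve-∀

    summed : α * (2 * (q * q)) + N * Σm² ≤ N * q * Σm
    summed = begin
      α * (2 * (q * q)) + N * Σm²  ≡⟨ cong₂ _+_ (≡-sym (∑-const A _)) (≡-sym (∑-* A N _)) ⟩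
      ∑ A (λ _ → 2 * (q * q)) + ∑ A (λ a → N * (m a * m a)) ≡⟨ ≡-sym (∑-+ A _ _) ⟩
      ∑ A (λ a → 2 * (q * q) + N * (m a * m a)) ≤⟨ ∑-mono A pointwise ⟩
      ∑ A (λ a → N * q * m a) ≡⟨ ∑-* A (N * q) m ⟩
      N * q * Σm ∎

    scaled : q * q * (N * e₂′ + (K * e₃ + α * w)) ≤ q * q * (N * (2 * e₁))
    scaled = begin
      q * q * (N * e₂′ + (K * e₃ + α * w))
        ≡⟨ l₁ q N e₂′ K e₃ α w ⟩
      N * (q * q * e₂′) + (K * q * (q * e₃) + q * q * α * w)
        ≤⟨ +-mono-≤ (*-monoʳ-≤ N e₂≤) (≤-reflexive (cong (λ x → K * q * x + q * q * α * w) e₃≡)) ⟩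
      N * (w * (q * Σm + Σm²)) + (K * q * (w * length B) + q * q * α * w)
        ≡⟨ l₂ N w q Σm Σm² K (length B) α ⟩
      w * (N * q * Σm + (N * Σm² + q * (K * length B) + q * q * α))
        ≤⟨ *-monoʳ-≤ w (+-monoʳ-≤ (N * q * Σm) (+-monoˡ-≤ (q * q * α) (+-monoʳ-≤ (N * Σm²) (*-monoʳ-≤ q small)))) ⟩
      w * (N * q * Σm + (N * Σm² + q * (q * α) + q * q * α))
        ≡⟨ cong (λ x → w * (N * q * Σm + x)) (l₃ N Σm² q α) ⟩
      w * (N * q * Σm + (α * (2 * (q * q)) + N * Σm²))
        ≤⟨ *-monoʳ-≤ w (+-monoʳ-≤ (N * q * Σm) summed) ⟩
      w * (N * q * Σm + N * q * Σm)
        ≡⟨ l₄ w N q Σm ⟩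
      2 * N * q * (w * Σm)
        ≡⟨ cong (2 * N * q *_) (≡-sym e₁≡) ⟩
      2 * N * q * (q * e₁)
        ≡⟨ l₅ N q e₁ ⟩
      q * q * (N * (2 * e₁)) ∎
      where
      l₁ : ∀ q N e K f α w → q * q * (N * e + (K * f + α * w)) ≡
                             N * (q * q * e) + (K * q * (q * f) + q * q * α * w)
      l₁ = solve-∀
      l₂ : ∀ N w q s t K b α → N * (w * (q * s + t)) + (K * q * (w * b) + q * q * α * w) ≡
                               w * (N * q * s + (N * t + q * (K * b) + q * q * α))
      l₂ = solve-∀
      l₃ : ∀ N t q α → N * t + q * (q * α) + q * q * α ≡ α * (2 * (q * q)) + N * t
      l₃ = solve-∀
      l₄ : ∀ w N q s → w * (N * q * s + N * q * s) ≡ 2 * N * q * (w * s)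
      l₄ = solve-∀
      l₅ : ∀ N q e → 2 * N * q * (q * e) ≡ q * q * (N * (2 * e))
      l₅ = solve-∀

    mean : 𝔼 r B R ≤ 𝔼 r B L
    mean = begin
      𝔼 r B R
        ≡⟨ trans (𝔼-+ r B _ _) (cong₂ _+_
             (trans (𝔼-* r B N _) (cong (N *_) (𝔼-∑ r A B (λ a X → deg X a * deg X a))))
             (trans (𝔼-+ r B _ _) (cong₂ _+_ (𝔼-* r B K _) (𝔼-const r B α)))) ⟩
      N * e₂′ + (K * e₃ + α * w)
        ≤⟨ *-cancelˡ-≤ (q * q) scaled ⟩
      N * (2 * e₁)
        ≡⟨ ≡-sym (trans (𝔼-* r B N _) (cong (N *_)
             (trans (𝔼-* r B 2 (λ X → ∑ A (deg X))) (cong (2 *_) (𝔼-∑ r A B (λ a X → deg X a)))))) ⟩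
      𝔼 r B L ∎

    conclude : ∀ X → R X ≤ L X → K * length X + α ≤ N * length (exactlyOne X A)
    conclude X R≤L = +-cancelˡ-≤ (N * s) _ _ (begin
      N * s + (K * length X + α)
        ≡⟨ cong (λ x → N * s + (K * x + α)) (≡-sym (trans (∑-const X 1) (*-identityʳ _))) ⟩
      R X                                  ≤⟨ R≤L ⟩
      L X                                  ≤⟨ *-monoʳ-≤ N (2d≤d²+[d=1] X A) ⟩
      N * (s + length (exactlyOne X A))    ≡⟨ *-distribˡ-+ N s _ ⟩
      N * s + N * length (exactlyOne X A)  ∎)
      where
      s = ∑ A (λ a → deg X a * deg X a)

-- Successive sampling of disjoint parts.

Unique-++⁻ : ∀ (xs : List Elt) {ys} → Unique (xs ++ ys) → Unique ys × (∀ {x} → x ∈ xs → x ∉ ys)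
Unique-++⁻ []       u        = u , λ ()
Unique-++⁻ (x ∷ xs) (x∉ ∷ u) with Unique-++⁻ xs u
... | uys , disjoint = uys , λ
  { (here refl) x∈ys → All.lookup x∉ (∈-++⁺ʳ xs x∈ys) refl
  ; (there y∈)  → disjoint y∈
  }

∑-++ : ∀ (xs ys : List Elt) f → ∑ (xs ++ ys) f ≡ ∑ xs f + ∑ ys f
∑-++ xs ys f = trans (cong sum (map-++ f xs ys)) (sum-++ (map f xs) (map f ys))

module Transversals (G : Graph) where
  open Degrees G
  open Sampling G

  record Parts (k N K : ℕ) (A B : List V) : Set where
    field
      A′       : List V
      X        : Fin k → List V
      uniqueA′ : Unique A′
      A′⊆A     : ∀ {a} → a ∈ A′ → a ∈ A
      X⊆B      : ∀ i {b} → b ∈ X i → b ∈ B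
      large    : length A ≤ N ^ k * length A′
      small    : ∀ i → K * length (X i) ≤ N ^ k * length A′
      one      : ∀ i {a} → a ∈ A′ → deg (X i) a ≡ 1
      disjoint : ∀ {i j b} → i ≢ j → b ∈ X i → b ∉ X j

  parts : ∀ k {r N K s A B} → .{{NonZero N}} → Unique A → Unique B →
    (∀ {a} → a ∈ A → 2 * deg B a ≤ suc r) →
    (∀ {a} → a ∈ A → s + k ≤ deg B a) → 4 * suc r ≤ N * s →
    N ^ k * (K * length B) ≤ suc r * length A → Parts k N K A B
  parts zero {A = A} uA uB _ _ _ _ = record
    { A′ = A ; X = λ () ; uniqueA′ = uA ; A′⊆A = λ a∈ → a∈ ; X⊆B = λ ()
    ; large = ≤-reflexive (≡-sym (+-identityʳ _)) ; small = λ () ; one = λ () ; disjoint = λ { {()} } }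
  parts (suc k) {r} {N} {K} {s} {A} {B} uA uB up low 4q≤Ns sparse =
    let X , Y , p , good = sample {r} {N} {K} A B up low₁ sparse₁ in step X Y p good
    where
    open ≤-Reasoning
    q = suc r

    low₁ : ∀ {a} → a ∈ A → 4 * q ≤ N * deg B a
    low₁ a∈ = ≤-trans 4q≤Ns (*-monoʳ-≤ N (≤-trans (m≤m+n s (suc k)) (low a∈)))

    sparse₁ : K * length B ≤ q * length A
    sparse₁ = ≤-trans (m≤n*m (K * length B) (N ^ suc k) {{m^n≢0 N (suc k)}}) sparse

    step : ∀ X Y → X ++ Y ↭ B → K * length X + length A ≤ N * length (exactlyOne X A) →
           Parts (suc k) N K A B
    step X Y p good = record
      { A′ = Rest.A′
      ; X = X′
      ; uniqueA′ = Rest.uniqueA′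
      ; A′⊆A = λ a∈ → A₁⊆A (Rest.A′⊆A a∈)
      ; X⊆B = λ { zero b∈ → ∈-resp-↭ p (∈-++⁺ˡ b∈) ; (suc i) b∈ → Y⊆B (Rest.X⊆B i b∈) }
      ; large = ≤-trans (m+n≤o⇒n≤o (K * length X) good) N|A₁|≤
      ; small = λ { zero → ≤-trans (m+n≤o⇒m≤o (K * length X) good) N|A₁|≤
                  ; (suc i) → ≤-trans (Rest.small i) (*-monoˡ-≤ (length Rest.A′) (m≤n*m (N ^ k) N)) }
      ; one = λ { zero a∈ → proj₂ (∈-filter⁻ one? {xs = A} (Rest.A′⊆A a∈)) ; (suc i) a∈ → Rest.one i a∈ }
      ; disjoint = disj
      }
      where
      A₁ = exactlyOne X A
      one? = λ a → deg X a ≟ 1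

      splitXY : Unique Y × (∀ {x} → x ∈ X → x ∉ Y)
      splitXY = Unique-++⁻ X (Unique-resp-↭ (↭-sym p) uB)

      A₁⊆A : ∀ {a} → a ∈ A₁ → a ∈ A
      A₁⊆A a∈ = proj₁ (∈-filter⁻ one? a∈)

      Y⊆B : ∀ {b} → b ∈ Y → b ∈ B
      Y⊆B b∈ = ∈-resp-↭ p (∈-++⁺ʳ X b∈)

      degY : ∀ {a} → a ∈ A₁ → deg B a ≡ suc (deg Y a)
      degY {a} a∈ = trans (≡-sym (∑-↭ _ p)) (trans (∑-++ X Y _)
        (cong (_+ deg Y a) (proj₂ (∈-filter⁻ one? {xs = A} a∈))))

      |Y|≤|B| : length Y ≤ length B
      |Y|≤|B| = subst (length Y ≤_) (trans (≡-sym (length-++ X)) (↭-length p)) (m≤n+m (length Y) (length X))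

      sparseY : N ^ k * (K * length Y) ≤ q * length A₁
      sparseY = *-cancelˡ-≤ N (begin
        N * (N ^ k * (K * length Y)) ≡⟨ ≡-sym (*-assoc N (N ^ k) _) ⟩
        N ^ suc k * (K * length Y)   ≤⟨ *-monoʳ-≤ (N ^ suc k) (*-monoʳ-≤ K |Y|≤|B|) ⟩
        N ^ suc k * (K * length B)   ≤⟨ sparse ⟩
        q * length A                 ≤⟨ *-monoʳ-≤ q (m+n≤o⇒n≤o (K * length X) good) ⟩
        q * (N * length A₁)          ≡⟨ lemma q N (length A₁) ⟩
        N * (q * length A₁)          ∎)
        where
        lemma : ∀ q N a → q * (N * a) ≡ N * (q * a)
        lemma = solve-∀

      rest : Parts k N K A₁ Y
      rest = parts k {s = s} (filter⁺ one? uA) (proj₁ splitXY)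
        (λ a∈ → ≤-trans (*-monoʳ-≤ 2 (≤-trans (n≤1+n _) (≤-reflexive (≡-sym (degY a∈))))) (up (A₁⊆A a∈)))
        (λ a∈ → s≤s⁻¹ (subst₂ _≤_ (+-suc s k) (degY a∈) (low (A₁⊆A a∈))))
        4q≤Ns sparseY
      module Rest = Parts rest

      N|A₁|≤ : N * length A₁ ≤ N ^ suc k * length Rest.A′
      N|A₁|≤ = ≤-trans (*-monoʳ-≤ N Rest.large) (≤-reflexive (≡-sym (*-assoc N (N ^ k) _)))

      X′ : Fin (suc k) → List V
      X′ zero    = X
      X′ (suc i) = Rest.X i

      disj : ∀ {i j b} → i ≢ j → b ∈ X′ i → b ∉ X′ j
      disj {zero}  {zero}  i≢j _  _   = i≢j refl
      disj {zero}  {suc j} i≢j b∈ b∈′ = proj₂ splitXY b∈ (Rest.X⊆B j b∈′)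
      disj {suc i} {zero}  i≢j b∈ b∈′ = proj₂ splitXY b∈′ (Rest.X⊆B i b∈)
      disj {suc i} {suc j} i≢j b∈ b∈′ = Rest.disjoint (i≢j ∘ cong suc) b∈ b∈′

-- Keys and rich coordinate lists

∈⇒remove : {x : Elt} {xs : List Elt} → x ∈ xs →
           ∃ λ ys → length xs ≡ suc (length ys) × (∀ {y} → y ∈ xs → y ≡ x ⊎ y ∈ ys)
∈⇒remove x∈ = let ys , p = ∈⇒↭ x∈ in ys , ↭-length p , λ y∈ → split (∈-resp-↭ p y∈)
  where
  split : {x y : Elt} {ys : List Elt} → y ∈ x ∷ ys → y ≡ x ⊎ y ∈ ys
  split (here y≡x) = inj₁ y≡x
  split (there y∈) = inj₂ y∈

infix 4 _,⊑_

record _⊑_ {S : Set} (xs ys : List S) : Set where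
  constructor _,⊑_
  field
    unique : Unique xs
    subset : ∀ {x} → x ∈ xs → x ∈ ys

-- The factor lost when `m` coordinate lists are made homogeneous. The sum dominates both outcomes
-- of a round: 2 if the core keeps half of the family, `2 * s * suc m * loss s m` if one passes to
-- the representatives removed for one list.
loss : ℕ → ℕ → ℕ
loss s zero    = 1
loss s (suc m) = 2 + 2 * s * suc m * loss s m

module Homogeneity {S I : Set} (_≟ᴵ_ : DecidableEquality I) (_∼⟨_⟩_ : S → I → S → Set)
  (_∼⟨_⟩?_ : ∀ x i y → Dec (x ∼⟨ i ⟩ y)) (∼-refl : ∀ {i x} → x ∼⟨ i ⟩ x)
  (∼-sym : ∀ {i x y} → x ∼⟨ i ⟩ y → y ∼⟨ i ⟩ x) (s : ℕ) where

  class : S → I → List S → List S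
  class x i = filter (x ∼⟨ i ⟩?_)

  Key : List S → I → Set
  Key F i = ∀ {x y} → x ∈ F → y ∈ F → x ∼⟨ i ⟩ y → x ≡ y

  Rich : List S → I → Set
  Rich F i = ∀ {x} → x ∈ F → s ≤ length (class x i F)

  -- Deleted elements are charged to representatives, so a small core forces some `removed i` to be
  -- large, and on that list `i` is a key.
  record Peeling (Is : List I) (F : List S) : Set where
    field
      core      : List S
      removed   : I → List S
      core⊑     : core ⊑ F
      removed⊑  : ∀ i → removed i ⊑ F
      rich      : ∀ {i} → i ∈ Is → Rich core i
      key       : ∀ i → Key (removed i) i
      count     : length F ≤ length core + s * ∑ Is (length ∘ removed)

  -- Classes with fewer than s elements are deleted one at a time; removed i keeps one
  -- representative of each class deleted on account of i.
  peel : ∀ Is m F → length F ≤ m → Unique F → Peeling Is F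
  peel Is m F |F|≤m u
    with Any.any? (λ x → Any.any? (λ i → length (class x i F) <? s) Is) F
  ... | no none = record
    { core = F ; removed = λ _ → [] ; core⊑ = u ,⊑ (λ x∈ → x∈) ; removed⊑ = λ _ → [] ,⊑ λ ()
    ; rich = λ i∈ x∈ → ≮⇒≥ λ poor → All.lookup (¬Any⇒All¬ F none) x∈ (lose i∈ poor)
    ; key = λ _ () ; count = m≤m+n _ _ }
  ... | yes some with find some
  ... | x , x∈ , some′ with find some′
  ... | i , i∈ , poor = extend m |F|≤m
    where
    open ≤-Reasoning
    F′ = filter (¬? ∘ (x ∼⟨ i ⟩?_)) F

    F′⊆F : ∀ {y} → y ∈ F′ → y ∈ F
    F′⊆F y∈ = proj₁ (∈-filter⁻ _ {xs = F} y∈)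

    |F′|<|F| : length F′ < length F
    |F′|<|F| = subst (length F′ <_) (≡-sym (length-filter-¬ (x ∼⟨ i ⟩?_) F))
      (+-monoˡ-≤ (length F′) (∈-length (∈-filter⁺ (x ∼⟨ i ⟩?_) x∈ ∼-refl)))

    extend : ∀ m → length F ≤ m → Peeling Is F
    extend zero    |F|≤0 = ⊥-elim (<⇒≱ (∈-length x∈) |F|≤0)
    extend (suc m) |F|≤m = record
      { core = P.core ; removed = removed′
      ; core⊑ = _⊑_.unique P.core⊑ ,⊑ (F′⊆F ∘ _⊑_.subset P.core⊑)
      ; removed⊑ = removed′⊑ ; rich = P.rich ; key = key′ ; count = count′ }
      where
      module P = Peeling (peel Is m F′ (s≤s⁻¹ (≤-trans |F′|<|F| |F|≤m)) (filter⁺ _ u))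

      removed′ : I → List S
      removed′ j with j ≟ᴵ i
      ... | yes _ = x ∷ P.removed j
      ... | no  _ = P.removed j

      -- Everything removed later comes from `F′`, outside the class of `x`; hence `x` can join
      -- `removed i` without spoiling the key.
      x≁ : ∀ {j y} → y ∈ P.removed j → ¬ x ∼⟨ i ⟩ y
      x≁ {j} y∈ = proj₂ (∈-filter⁻ (¬? ∘ (x ∼⟨ i ⟩?_)) {xs = F} (_⊑_.subset (P.removed⊑ j) y∈))

      removed′⊑ : ∀ j → removed′ j ⊑ F
      removed′⊑ j with j ≟ᴵ i
      ... | yes _ = (All.tabulate (λ { y∈ refl → x≁ y∈ ∼-refl }) ∷ _⊑_.unique (P.removed⊑ j)) ,⊑
                    λ { (here refl) → x∈ ; (there y∈) → F′⊆F (_⊑_.subset (P.removed⊑ j) y∈) }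
      ... | no  _ = _⊑_.unique (P.removed⊑ j) ,⊑ (F′⊆F ∘ _⊑_.subset (P.removed⊑ j))

      key′ : ∀ j → Key (removed′ j) j
      key′ j with j ≟ᴵ i
      ... | no  _    = P.key j
      ... | yes refl = λ where
        (here refl) (here refl) _   → refl
        (here refl) (there z∈)  x∼z → ⊥-elim (x≁ z∈ x∼z)
        (there y∈)  (here refl) y∼x → ⊥-elim (x≁ y∈ (∼-sym y∼x))
        (there y∈)  (there z∈)  y∼z → P.key j y∈ z∈ y∼z

      grows : ∀ j → length (P.removed j) ≤ length (removed′ j)
      grows j with j ≟ᴵ i
      ... | yes _ = n≤1+n _
      ... | no  _ = ≤-refl

      grows-i : length (P.removed i) < length (removed′ i)
      grows-i with i ≟ᴵ i
      ... | yes _   = ≤-refl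
      ... | no  i≢i = ⊥-elim (i≢i refl)

      count′ : length F ≤ length P.core + s * ∑ Is (length ∘ removed′)
      count′ = begin
        length F                        ≡⟨ length-filter-¬ (x ∼⟨ i ⟩?_) F ⟩
        length (class x i F) + length F′ ≤⟨ +-mono-≤ (<⇒≤ poor) P.count ⟩
        s + (length P.core + s * σ)     ≡⟨ lemma s (length P.core) σ ⟩
        length P.core + s * suc σ
          ≤⟨ +-monoʳ-≤ (length P.core) (*-monoʳ-≤ s (∑-mono-< Is (λ {j} _ → grows j) i∈ grows-i)) ⟩
        length P.core + s * ∑ Is (length ∘ removed′) ∎
        where
        σ = ∑ Is (length ∘ P.removed)
        lemma : ∀ s c σ → s + (c + s * σ) ≡ c + s * suc σ
        lemma = solve-∀

  record Homogeneous (Is : List I) (F : List S) (c : ℕ) : Set where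
    field
      F′    : List S
      F′⊑F  : F′ ⊑ F
      large : length F ≤ c * length F′
      dich  : ∀ {i} → i ∈ Is → Key F′ i ⊎ Rich F′ i

  -- If every `removed i` is small, the core keeps half of `F` and all lists are rich on it.
  -- Otherwise one passes to a large `removed i`, where `i` is a key. Sublists inherit keys but not
  -- richness, so `i` is settled for good and the other lists are treated afresh.
  homogenise : ∀ m Is F → length Is ≡ m → Unique F → Homogeneous Is F (loss s m)
  homogenise zero    []  F _ u = record
    { F′ = F ; F′⊑F = u ,⊑ (λ x∈ → x∈) ; large = ≤-reflexive (≡-sym (+-identityʳ _)) ; dich = λ () }
  homogenise (suc m) Is F |Is| u = choose (peel Is (length F) F ≤-refl u)
    where
    open ≤-Reasoning
    choose : Peeling Is F → Homogeneous Is F (loss s (suc m))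
    choose P with Any.any? (λ i → length F ≤? 2 * s * suc m * length (Peeling.removed P i)) Is
    ... | no none = record
      { F′ = core ; F′⊑F = core⊑ ; dich = inj₂ ∘ rich
      ; large = ≤-trans (+-cancelʳ-≤ (length F) _ _ (begin
          length F + length F               ≡⟨ cong (length F +_) (≡-sym (+-identityʳ _)) ⟩
          2 * length F                      ≤⟨ *-monoʳ-≤ 2 count ⟩
          2 * (length core + s * σ)         ≡⟨ lemma (length core) s σ ⟩
          2 * length core + 2 * s * σ       ≤⟨ +-monoʳ-≤ (2 * length core) few ⟩
          2 * length core + length F        ∎)) (*-monoˡ-≤ (length core) (m≤m+n 2 (2 * s * suc m * loss s m)))
      }
      where
      open Peeling P
      σ = ∑ Is (length ∘ removed)
      lemma : ∀ c s σ → 2 * (c + s * σ) ≡ 2 * c + 2 * s * σ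
      lemma = solve-∀
      lemma′ : ∀ k s σ → k * (2 * s * σ) ≡ 2 * s * k * σ
      lemma′ = solve-∀
      -- Each of the `suc m` lists accounts for at most 1 / (2 · `suc m`) of `F`, so at most half of
      -- `F` is deleted.
      few : 2 * s * σ ≤ length F
      few = *-cancelˡ-≤ (suc m) (begin
        suc m * (2 * s * σ)  ≡⟨ lemma′ (suc m) s σ ⟩
        2 * s * suc m * σ    ≡⟨ ≡-sym (∑-* Is (2 * s * suc m) (length ∘ removed)) ⟩
        ∑ Is (λ i → 2 * s * suc m * length (removed i))
          ≤⟨ ∑-mono Is (λ i∈ → ≰⇒≥ (All.lookup (¬Any⇒All¬ Is none) i∈)) ⟩
        ∑ Is (λ _ → length F) ≡⟨ trans (∑-const Is (length F)) (cong (_* length F) |Is|) ⟩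
        suc m * length F     ∎)
    ... | yes some with find some
    ... | i , i∈ , big with ∈⇒remove i∈
    ... | Js , |Is|≡ , split = record
      { F′ = H.F′
      ; F′⊑F = _⊑_.unique H.F′⊑F ,⊑ (_⊑_.subset (removed⊑ i) ∘ _⊑_.subset H.F′⊑F)
      ; large = begin
          length F                                       ≤⟨ big ⟩
          2 * s * suc m * length (removed i)             ≤⟨ *-monoʳ-≤ (2 * s * suc m) H.large ⟩
          2 * s * suc m * (loss s m * length H.F′)         ≡⟨ ≡-sym (*-assoc (2 * s * suc m) (loss s m) _) ⟩
          2 * s * suc m * loss s m * length H.F′           ≤⟨ *-monoˡ-≤ (length H.F′) (m≤n+m (2 * s * suc m * loss s m) 2) ⟩
          loss s (suc m) * length H.F′                     ∎
      ; dich = λ j∈ → dich′ (split j∈)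
      }
      where
      open Peeling P
      module H = Homogeneous (homogenise m Js (removed i)
        (suc-injective (trans (≡-sym |Is|≡) |Is|)) (_⊑_.unique (removed⊑ i)))
      dich′ : ∀ {j} → j ≡ i ⊎ j ∈ Js → Key H.F′ j ⊎ Rich H.F′ j
      dich′ (inj₁ refl) = inj₁ λ x∈ y∈ → key i (_⊑_.subset H.F′⊑F x∈) (_⊑_.subset H.F′⊑F y∈)
      dich′ (inj₂ j∈)   = H.dich j∈

-- Greedy choice of coordinates.

split : ∀ {S : Set} {P Q : S → Set} → (∀ x → P x ⊎ Q x) → ∀ xs → Unique xs →
        ∃₂ λ ps qs → length xs ≡ length ps + length qs × ps ⊑ xs × qs ⊑ xs ×
                     (∀ {x} → x ∈ ps → P x) × (∀ {x} → x ∈ qs → Q x)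
split P⊎Q []       u = [] , [] , refl , ([] ,⊑ λ ()) , ([] ,⊑ λ ()) , (λ ()) , (λ ())
split {S} P⊎Q (x ∷ xs) (x∉ ∷ u) with P⊎Q x | split P⊎Q xs u
... | inj₁ p | ps , qs , eq , (ups ,⊑ ps⊆) , (uqs ,⊑ qs⊆) , Ps , Qs =
  x ∷ ps , qs , cong suc eq , (All.tabulate (All.lookup x∉ ∘ ps⊆) ∷ ups ,⊑
    λ { (here refl) → here refl ; (there y∈) → there (ps⊆ y∈) }) , (uqs ,⊑ (there ∘ qs⊆)) ,
  (λ { (here refl) → p ; (there y∈) → Ps y∈ }) , Qs
... | inj₂ q | ps , qs , eq , (ups ,⊑ ps⊆) , (uqs ,⊑ qs⊆) , Ps , Qs =
  ps , x ∷ qs , trans (cong suc eq) (≡-sym (+-suc _ _)) , (ups ,⊑ (there ∘ ps⊆)) ,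
  (All.tabulate (All.lookup x∉ ∘ qs⊆) ∷ uqs ,⊑
    λ { (here refl) → here refl ; (there y∈) → there (qs⊆ y∈) }) ,
  Ps , (λ { (here refl) → q ; (there y∈) → Qs y∈ })

-- The number of candidates needed with `r` rounds to go: a round selects up to `t` coordinates, and
-- each may cost itself and as many others as the next round needs.
enough : ℕ → ℕ → ℕ
enough t zero    = 1
enough t (suc r) = t * suc (enough t r)

module Coordinates {C : Set} (t : ℕ) (Key Rich : List C → Set) where

  KeyPairs : List C → List C → Set
  KeyPairs R = AllPairs (λ i j → Key (j ∷ i ∷ R))

  LongRich : Set
  LongRich = ∃ λ I → length I ≡ t × Unique I × Rich I

  -- Richness of the lists `j ∷ R` will give large degrees, and the keys in `keys` will exclude
  -- 4-cycles.
  record Flower : Set where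
    field
      R S    : List C
      |S|    : length S ≡ t
      unique : Unique S
      rich   : ∀ {j} → j ∈ S → Rich (j ∷ R)
      keys   : KeyPairs R S

  module _ (dich : ∀ {i I} → suc (length I) ≤ t → Key (i ∷ I) ⊎ Rich (i ∷ I)) where

    -- Take the first candidate `i` and sort the rest by whether they form a key or a rich list with
    -- `i` and `R`. Either `m` are rich, which is the star, or fewer than `m` are discarded and the
    -- search goes on among the key partners; a pick thus costs at most `suc m` candidates.
    keyPairs⊎star : ∀ c m R X → 2 + length R ≤ t → Unique X → c * suc m ≤ length X →
      (∃ λ S → length S ≡ c × S ⊑ X × KeyPairs R S) ⊎
      (∃₂ λ i Q → i ∈ X × m ≤ length Q × Q ⊑ X × (∀ {j} → j ∈ Q → i ≢ j × Rich (j ∷ i ∷ R)))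
    keyPairs⊎star zero    m R X       _  _ _ = inj₁ ([] , refl , ([] ,⊑ λ ()) , [])
    keyPairs⊎star (suc c) m R (i ∷ X) R≤ (i∉ ∷ u) |X|
      with split (λ j → dich {j} {i ∷ R} R≤) X u
    ... | K , Q , eq , (uK ,⊑ K⊆) , (uQ ,⊑ Q⊆) , Ks , Qs with m ≤? length Q
    ... | yes m≤ = inj₂ (i , Q , here refl , m≤ , (uQ ,⊑ (there ∘ Q⊆)) , λ j∈ → All.lookup i∉ (Q⊆ j∈) , Qs j∈)
    ... | no  m≰ with keyPairs⊎star c m R K R≤ uK (+-cancelʳ-≤ m _ _ (begin
            c * suc m + m           ≡⟨ +-comm (c * suc m) m ⟩
            m + c * suc m           ≤⟨ s≤s⁻¹ |X| ⟩
            length X                ≡⟨ eq ⟩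
            length K + length Q     ≤⟨ +-monoʳ-≤ (length K) (≰⇒≥ m≰) ⟩
            length K + m            ∎))
            where open ≤-Reasoning
    ... | inj₂ (j , P , j∈ , m≤ , (uP ,⊑ P⊆) , Ps) =
      inj₂ (j , P , there (K⊆ j∈) , m≤ , (uP ,⊑ (there ∘ K⊆ ∘ P⊆)) , Ps)
    ... | inj₁ (S , |S| , (uS ,⊑ S⊆) , keys) = inj₁ (i ∷ S , cong suc |S| ,
      (All.tabulate (All.lookup i∉ ∘ K⊆ ∘ S⊆) ∷ uS ,⊑
        λ { (here refl) → here refl ; (there y∈) → there (K⊆ (S⊆ y∈)) }) ,
      All.tabulate (Ks ∘ S⊆) ∷ keys)

    -- A star moves its centre `i` into `R` and leaves its leaves as candidates, each still rich
    -- with the longer list. With no rounds left, `R` has `t` - 1 entries and any candidate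
    -- completes it to a rich list of length `t`.
    longRich⊎flower : ∀ r R X → suc (length R + r) ≡ t → Unique X → enough t r ≤ length X →
      (∀ {j} → j ∈ X → Unique (j ∷ R) × Rich (j ∷ R)) → LongRich ⊎ Flower
    longRich⊎flower zero    R (j ∷ X) eq u |X| rich =
      inj₁ (j ∷ R , trans (cong suc (≡-sym (+-identityʳ _))) eq , rich (here refl))
    longRich⊎flower (suc r) R X eq u |X| rich
      with keyPairs⊎star t (enough t r) R X
             (≤-trans (m≤m+n (2 + length R) r)
               (≤-reflexive (trans (cong suc (≡-sym (+-suc (length R) r))) eq))) u |X|
    ... | inj₁ (S , |S| , (uS ,⊑ S⊆) , keys) = inj₂ record
      { R = R ; S = S ; |S| = |S| ; unique = uS ; rich = proj₂ ∘ rich ∘ S⊆ ; keys = keys }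
    ... | inj₂ (i , Q , i∈ , m≤ , (uQ ,⊑ Q⊆) , richQ) =
      longRich⊎flower r (i ∷ R) Q (trans (cong suc (≡-sym (+-suc (length R) r))) eq) uQ m≤
        (λ j∈ → (((proj₁ (richQ j∈) ∘ ≡-sym) ∷ AllPairs.head (proj₁ (rich (Q⊆ j∈)))) ∷ proj₁ (rich i∈)) ,
          proj₂ (richQ j∈))

-- Induced subgraphs of large girth

∑-lookup : ∀ {S : Set} (xs : List S) f → ∑ (allFin (length xs)) (f ∘ lookup xs) ≡ ∑ xs f
∑-lookup xs f = cong sum (trans (map-tabulate (λ i → i) (f ∘ lookup xs))
  (trans (≡-sym (map-tabulate (lookup xs) f)) (cong (map f) (tabulate-lookup xs))))

≢-≢⇒≡ : ∀ {x y z : Bool} → x ≢ y → y ≢ z → x ≡ z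
≢-≢⇒≡ x≢y y≢z = trans (¬-not x≢y) (≡-sym (¬-not (y≢z ∘ ≡-sym)))

module InducedSubgraph (G : Graph) (col : Fin (n G) → Bool)
  (proper : ∀ u v → adj G u v ≡ true → col u ≢ col v) where
  open Degrees G

  DenseGirth₆Subgraph : ℕ → Set
  DenseGirth₆Subgraph t = Σ ℕ λ m → Σ (Fin m → Fin (n G)) λ ι → Injective _≡_ _≡_ ι ×
    AvgDegreeAtLeast (induced G ι) t × GirthAtLeast (induced G ι) 6

  -- Stating `linear` from one side suffices, because a 4-cycle in a bipartite graph has two
  -- vertices on each side.
  record C₄Free (t : ℕ) (c : Bool) (F B : List V) : Set where
    field
      uniqueF  : Unique F
      uniqueB  : Unique B
      nonempty : 1 ≤ length F
      colF     : ∀ {a} → a ∈ F → col a ≡ c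
      colB     : ∀ {b} → b ∈ B → col b ≢ c
      degF     : ∀ {a} → a ∈ F → t ≤ deg B a
      degB     : ∀ {b} → b ∈ B → t ≤ deg F b
      linear   : ∀ {a a′ b b′} → a ∈ F → a′ ∈ F → b ∈ B → b′ ∈ B → b ≢ b′ →
                 adj G a b ≡ true → adj G a b′ ≡ true → adj G a′ b ≡ true → adj G a′ b′ ≡ true → a ≡ a′

  adj-sym : ∀ {u v} → adj G u v ≡ true → adj G v u ≡ true
  adj-sym {u} {v} e = trans (Graph.sym G v u) e

  -- The induced graph on `F ++ B` has minimum degree at least `t`. Colours exclude cycles of
  -- lengths 3 and 5, and `linear` those of length 4.
  c₄Free⇒girth₆ : ∀ {t c F B} → C₄Free t c F B → DenseGirth₆Subgraph t
  c₄Free⇒girth₆ {t} {c} {F} {B} P = length L , lookup L , injective , (1≤|L| , avg) , girth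
    where
    open C₄Free P
    open ≤-Reasoning
    L = F ++ B

    injective : Injective _≡_ _≡_ (lookup L)
    injective = lookup-injective (++⁺ uniqueF uniqueB λ (v∈F , v∈B) → colB v∈B (colF v∈F))

    1≤|L| : 1 ≤ length L
    1≤|L| = ≤-trans nonempty (≤-trans (m≤m+n _ _) (≤-reflexive (≡-sym (length-++ F))))

    degL : ∀ {v} → v ∈ L → t ≤ deg L v
    degL {v} v∈ with ∈-++⁻ F v∈
    ... | inj₁ v∈F = ≤-trans (degF v∈F) (≤-trans (m≤n+m _ _) (≤-reflexive (≡-sym (∑-++ F B _))))
    ... | inj₂ v∈B = ≤-trans (degB v∈B) (≤-trans (m≤m+n _ _) (≤-reflexive (≡-sym (∑-++ F B _))))

    avg : t * length L ≤ degreeSum (induced G (lookup L))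
    avg = begin
      t * length L                    ≡⟨ *-comm t (length L) ⟩
      length L * t                    ≡⟨ cong (_* t) (≡-sym (length-tabulate {n = length L} (λ i → i))) ⟩
      length (allFin (length L)) * t  ≤⟨ ∑-const-≤ (allFin (length L)) (λ {i} _ →
        ≤-trans (degL (∈-lookup {xs = L} i)) (≤-reflexive (≡-sym (∑-lookup L (λ u → 𝟙 (adj G (lookup L i) u)))))) ⟩
      degreeSum (induced G (lookup L)) ∎

    ∈F : ∀ {v} → v ∈ L → col v ≡ c → v ∈ F
    ∈F v∈ eq with ∈-++⁻ F v∈
    ... | inj₁ v∈F = v∈F
    ... | inj₂ v∈B = ⊥-elim (colB v∈B eq)

    ∈B : ∀ {v} → v ∈ L → col v ≢ c → v ∈ B
    ∈B v∈ neq with ∈-++⁻ F v∈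
    ... | inj₁ v∈F = ⊥-elim (neq (colF v∈F))
    ... | inj₂ v∈B = v∈B

    no-C₄ : ∀ {v₀ v₁ v₂ v₃} → v₀ ∈ L → v₁ ∈ L → v₂ ∈ L → v₃ ∈ L → v₀ ≢ v₂ → v₁ ≢ v₃ →
      adj G v₀ v₁ ≡ true → adj G v₁ v₂ ≡ true → adj G v₂ v₃ ≡ true → adj G v₃ v₀ ≡ true → ⊥
    -- Depending on the colour of `v₀`, the opposite pair lying in `F` is `v₀`, `v₂` or `v₁`, `v₃`.
    no-C₄ {v₀} {v₁} {v₂} {v₃} i₀ i₁ i₂ i₃ v₀≢v₂ v₁≢v₃ e₀ e₁ e₂ e₃ with col v₀ Bool.≟ c
    ... | yes c₀ = v₀≢v₂ (linear (∈F i₀ c₀) (∈F i₂ (trans (≡-sym 0≡2) c₀))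
            (∈B i₁ (λ c₁ → proper _ _ e₀ (trans c₀ (≡-sym c₁))))
            (∈B i₃ (λ c₃ → proper _ _ e₃ (trans c₃ (≡-sym c₀))))
            v₁≢v₃ e₀ (adj-sym e₃) (adj-sym e₁) e₂)
      where
      0≡2 : col v₀ ≡ col v₂
      0≡2 = ≢-≢⇒≡ (proper _ _ e₀) (proper _ _ e₁)
    ... | no c₀ = v₁≢v₃ (linear (∈F i₁ (≢-≢⇒≡ (proper _ _ (adj-sym e₀)) c₀)) (∈F i₃ (≢-≢⇒≡ (proper _ _ e₃) c₀))
            (∈B i₀ c₀) (∈B i₂ λ c₂ → c₀ (trans 0≡2 c₂)) v₀≢v₂ (adj-sym e₀) e₁ e₃ (adj-sym e₂))
      where
      0≡2 : col v₀ ≡ col v₂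
      0≡2 = ≢-≢⇒≡ (proper _ _ e₀) (proper _ _ e₁)

    girth : GirthAtLeast (induced G (lookup L)) 6
    girth .1 (0 , refl , s≤s () , _)
    girth .2 (1 , refl , s≤s (s≤s ()) , _)
    girth .3 (2 , refl , _ , v , _ , e , close) =
      ⊥-elim (proper _ _ close (≡-sym (≢-≢⇒≡ (proper _ _ (e zero)) (proper _ _ (e (suc zero))))))
    girth .4 (3 , refl , _ , v , inj , e , close) =
      ⊥-elim (no-C₄ (∈v zero) (∈v (suc zero)) (∈v (suc (suc zero))) (∈v (suc (suc (suc zero))))
        (λ eq → case-0≢2 (inj (injective eq))) (λ eq → case-1≢3 (inj (injective eq)))
        (e zero) (e (suc zero)) (e (suc (suc zero))) close)
      where
      ∈v : ∀ i → lookup L (v i) ∈ L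
      ∈v i = ∈-lookup {xs = L} (v i)
      case-0≢2 : zero ≢ Fin.suc {3} (suc zero)
      case-0≢2 ()
      case-1≢3 : suc zero ≢ Fin.suc {3} (suc (suc zero))
      case-1≢3 ()
    girth .5 (4 , refl , _ , v , _ , e , close) =
      ⊥-elim (proper _ _ close (≡-sym (trans (two zero (e zero) (e (suc zero)))
        (two (suc (suc zero)) (e (suc (suc zero))) (e (suc (suc (suc zero))))))))
      where
      two : ∀ i {u w} → adj G (lookup L (v i)) u ≡ true → adj G u w ≡ true → col (lookup L (v i)) ≡ col w
      two i e e′ = ≢-≢⇒≡ (proper _ _ e) (proper _ _ e′)
    girth _ (suc (suc (suc (suc (suc k)))) , refl , _) = s≤s (s≤s (s≤s (s≤s (s≤s (s≤s z≤n)))))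

-- Vertices as tuples of neighbours, and the assembly.

module Neighbours (G : Graph) where
  open Degrees G

  deg≡length : ∀ X v → deg X v ≡ length (filter (λ u → adj G v u Bool.≟ true) X)
  deg≡length []      v = refl
  deg≡length (u ∷ X) v with adj G v u
  ... | true  = cong suc (deg≡length X v)
  ... | false = deg≡length X v

  length≤deg : ∀ {S : Set} {L : List S} {X v} (g : S → V) → Unique L →
    (∀ {x} → x ∈ L → g x ∈ X × adj G v (g x) ≡ true) →
    (∀ {x y} → x ∈ L → y ∈ L → g x ≡ g y → x ≡ y) → length L ≤ deg X v
  length≤deg {X = X} {v} g u g∈ inj = ≤-trans
    (length-≤-inj g u (λ x∈ → let gx∈ , e = g∈ x∈ in ∈-filter⁺ _ gx∈ e) inj)
    (≤-reflexive (≡-sym (deg≡length X v)))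

  -- The junk value v is returned when v has no neighbour in X.
  nbr : List V → V → V
  nbr []      v = v
  nbr (u ∷ X) v = if adj G v u then u else nbr X v

  deg≡0 : ∀ X {v u} → deg X v ≡ 0 → u ∈ X → adj G v u ≢ true
  deg≡0 (_ ∷ X) d≡0 (here refl) e rewrite e = case d≡0 of λ ()
  deg≡0 (w ∷ X) d≡0 (there u∈)  e = deg≡0 X (m+n≡0⇒n≡0 (𝟙 _) d≡0) u∈ e

  nbr-unique : ∀ X {v} → deg X v ≡ 1 →
    nbr X v ∈ X × adj G v (nbr X v) ≡ true × (∀ {u} → u ∈ X → adj G v u ≡ true → u ≡ nbr X v)
  nbr-unique (u ∷ X) {v} d≡1 with adj G v u in eq
  ... | true  = here refl , eq , λ
    { (here refl) _ → refl ; (there w∈) e → ⊥-elim (deg≡0 X (suc-injective d≡1) w∈ e) }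
  ... | false = let n∈ , e , uniq = nbr-unique X d≡1 in there n∈ , e , λ
    { (here refl) e′ → case trans (≡-sym eq) e′ of λ () ; (there w∈) e′ → uniq w∈ e′ }

-- Shorter lists are included, and so are repetitions and reorderings: only a finite supply
-- containing every short list is wanted, and its length enters `loss`.
words : ∀ {C : Set} → List C → ℕ → List (List C)
words cs zero    = [] ∷ []
words cs (suc l) = [] ∷ cartesianProductWith _∷_ cs (words cs l)

∈-words : ∀ {C : Set} {cs : List C} l {I} → length I ≤ l → (∀ c → c ∈ cs) → I ∈ words cs l
∈-words zero    {[]}    _       _   = here refl
∈-words (suc l) {[]}    _       _   = here refl
∈-words (suc l) {i ∷ I} (s≤s p) all = there (∈-cartesianProductWith⁺ _∷_ (all i) (∈-words l p all))

module Assembly (G : Graph) (col : Fin (n G) → Bool)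
  (proper : ∀ u v → adj G u v ≡ true → col u ≢ col v) {t₀ N K : ℕ} where
  open Degrees G
  open Transversals G
  open Neighbours G
  open InducedSubgraph G col proper

  private
    t = suc t₀
    -- The greedy choice starts from the empty `R`, with `t₀` rounds to go and all coordinates as
    -- candidates.
    k = enough t t₀
    I = List (Fin k)

  module _ {A B : List V} {c : Bool} (colA : ∀ {a} → a ∈ A → col a ≡ c) (colB : ∀ {b} → b ∈ B → col b ≢ c)
    (P : Parts k N K A B) where
    open Parts P

    -- The tuple attached to a vertex of `A′`: its unique neighbours in the parts.
    τ : V → Fin k → V
    τ a i = nbr (X i) a

    τ∈ : ∀ {a} → a ∈ A′ → ∀ i → τ a i ∈ X i
    τ∈ a∈ i = proj₁ (nbr-unique (X i) (one i a∈))

    adj-τ : ∀ {a} → a ∈ A′ → ∀ i → adj G a (τ a i) ≡ true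
    adj-τ a∈ i = proj₁ (proj₂ (nbr-unique (X i) (one i a∈)))

    τ-unique : ∀ {a} → a ∈ A′ → ∀ i {b} → b ∈ X i → adj G a b ≡ true → b ≡ τ a i
    τ-unique a∈ i = proj₂ (proj₂ (nbr-unique (X i) (one i a∈)))

    τ-injective : ∀ {a} → a ∈ A′ → ∀ {i j} → τ a i ≡ τ a j → i ≡ j
    τ-injective a∈ {i} {j} eq with i Fin.≟ j
    ... | yes i≡j = i≡j
    ... | no  i≢j = ⊥-elim (disjoint i≢j (τ∈ a∈ i) (subst (_∈ X j) (≡-sym eq) (τ∈ a∈ j)))

    _∼⟨_⟩_ : V → I → V → Set
    a ∼⟨ J ⟩ a′ = All (λ i → τ a i ≡ τ a′ i) J

    _∼⟨_⟩?_ : ∀ a J a′ → Dec (a ∼⟨ J ⟩ a′)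
    a ∼⟨ J ⟩? a′ = all? (λ i → τ a i Fin.≟ τ a′ i) J

    ∼-sym : ∀ {J a a′} → a ∼⟨ J ⟩ a′ → a′ ∼⟨ J ⟩ a
    ∼-sym = All.map ≡-sym

    ∼-trans : ∀ {J a a′ a″} → a ∼⟨ J ⟩ a′ → a′ ∼⟨ J ⟩ a″ → a ∼⟨ J ⟩ a″
    ∼-trans p q = All.zipWith (λ (e , e′) → trans e e′) (p , q)

    open Homogeneity (≡-dec Fin._≟_) _∼⟨_⟩_ _∼⟨_⟩?_ (λ {J} {a} → All.tabulate (λ _ → refl)) ∼-sym t

    module _ {F : List V} (F⊑A′ : F ⊑ A′) {f : V} (f∈F : f ∈ F) where

      open _⊑_ F⊑A′ renaming (subset to F⊆A′; unique to uniqueF)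

      class⊆F : ∀ {a J x} → x ∈ class a J F → x ∈ F
      class⊆F {a} {J} x∈ = proj₁ (∈-filter⁻ (a ∼⟨ J ⟩?_) x∈)

      class-∼ : ∀ {a J x} → x ∈ class a J F → a ∼⟨ J ⟩ x
      class-∼ {a} {J} x∈ = proj₂ (∈-filter⁻ (a ∼⟨ J ⟩?_) {xs = F} x∈)

      -- The vertices that agree with `f` on `J` are all joined to the entries of the tuple of `f`
      -- at `J`, which are distinct because the parts are disjoint.
      longRich⇒Ktt : ∀ {J} → length J ≡ t → Unique J → Rich F J → HasKtt G t
      longRich⇒Ktt {J} |J| uJ rich = a , b , a-injective , b-injective , a≢b , edge
        where
        C = class f J F
        t≤|C| : t ≤ length C
        t≤|C| = rich f∈F
        t≤|J| : t ≤ length J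
        t≤|J| = ≤-reflexive (≡-sym |J|)

        a b : Fin t → V
        a i = lookup C (inject≤ i t≤|C|)
        b j = τ f (lookup J (inject≤ j t≤|J|))

        a-injective : Injective _≡_ _≡_ a
        a-injective eq = inject≤-injective t≤|C| t≤|C| _ _
          (lookup-injective (filter⁺ (f ∼⟨ J ⟩?_) uniqueF) eq)

        b-injective : Injective _≡_ _≡_ b
        b-injective eq = inject≤-injective t≤|J| t≤|J| _ _
          (lookup-injective uJ (τ-injective (F⊆A′ f∈F) eq))

        edge : ∀ i j → adj G (a i) (b j) ≡ true
        edge i j = subst (λ v → adj G (a i) v ≡ true)
          (≡-sym (All.lookup (class-∼ a∈C) (∈-lookup {xs = J} (inject≤ j t≤|J|))))
          (adj-τ (F⊆A′ (class⊆F {f} {J} a∈C)) (lookup J (inject≤ j t≤|J|)))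
          where
          a∈C : a i ∈ C
          a∈C = ∈-lookup {xs = C} (inject≤ i t≤|C|)

        a≢b : ∀ i j → a i ≢ b j
        a≢b i j eq = case trans (≡-sym (irrefl G (b j))) (subst (λ v → adj G v (b j) ≡ true) eq (edge i j)) of λ ()

      -- One side `D` is the class of `f` on `R`, the other side `E` consists of the entries of its
      -- tuples at `S`. A vertex of `D` sees its own entries at `S`. For `τ a j` in `E`, richness of
      -- `j ∷ R` gives `t` vertices agreeing with `a` there; they lie in `D` and are adjacent to
      -- `τ a j`.
      flower⇒girth₆ : Coordinates.Flower t (Key F) (Rich F) → DenseGirth₆Subgraph t
      flower⇒girth₆ flower = c₄Free⇒girth₆ {c = c} {D} {E} (record
        { uniqueF = filter⁺ (f ∼⟨ R ⟩?_) uniqueF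
        ; uniqueB = filter⁺ hit? (allFin⁺ (n G))
        ; nonempty = ∈-length (∈-filter⁺ (f ∼⟨ R ⟩?_) f∈F (All.tabulate (λ _ → refl)))
        ; colF = colA ∘ A′⊆A ∘ D⊆A′
        ; colB = λ b∈ → let a , j , a∈ , j∈ , b≡ = E⁻ b∈ in
            subst (λ v → col v ≢ c) b≡ (colB (X⊆B j (τ∈ (D⊆A′ a∈) j)))
        ; degF = λ {a} a∈ → subst (_≤ deg E a) |S| (length≤deg (τ a) unique
            (λ {j} j∈ → E⁺ a∈ j∈ , adj-τ (D⊆A′ a∈) j) (λ _ _ → τ-injective (D⊆A′ a∈)))
        ; degB = degE
        ; linear = lin
        })
        where
        open Coordinates.Flower flower
        D = class f R F

        D⊆A′ : ∀ {a} → a ∈ D → a ∈ A′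
        D⊆A′ a∈ = F⊆A′ (class⊆F {f} {R} a∈)

        -- Different vertices of `D` may share an entry; filtering `allFin` lists each entry once.
        hit? = λ v → Any.any? (λ a → Any.any? (λ j → τ a j Fin.≟ v) S) D
        E = filter hit? (allFin (n G))

        E⁻ : ∀ {b} → b ∈ E → ∃₂ λ a j → a ∈ D × j ∈ S × τ a j ≡ b
        E⁻ b∈ with find (proj₂ (∈-filter⁻ hit? {xs = allFin (n G)} b∈))
        ... | a , a∈ , some with find some
        ... | j , j∈ , eq = a , j , a∈ , j∈ , eq

        E⁺ : ∀ {a j} → a ∈ D → j ∈ S → τ a j ∈ E
        E⁺ a∈ j∈ = ∈-filter⁺ hit? (∈-allFin _) (lose a∈ (lose j∈ refl))

        degE : ∀ {b} → b ∈ E → t ≤ deg D b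
        degE b∈ with E⁻ b∈
        ... | a , j , a∈ , j∈ , refl = ≤-trans (rich j∈ (class⊆F {f} {R} a∈))
          (length≤deg (λ x → x) (filter⁺ (a ∼⟨ j ∷ R ⟩?_) uniqueF) inD (λ _ _ eq → eq))
          where
          inD : ∀ {x} → x ∈ class a (j ∷ R) F → x ∈ D × adj G (τ a j) x ≡ true
          inD x∈ with class-∼ {a} {j ∷ R} x∈
          ... | τa≡τx ∷ a∼x = ∈-filter⁺ (f ∼⟨ R ⟩?_) x∈F (∼-trans (class-∼ {f} {R} a∈) a∼x) ,
            adj-sym (subst (λ v → adj G _ v ≡ true) (≡-sym τa≡τx) (adj-τ (F⊆A′ x∈F) j))
            where
            x∈F = class⊆F {a} {j ∷ R} x∈

        lin : ∀ {a a′ b b′} → a ∈ D → a′ ∈ D → b ∈ E → b′ ∈ E → b ≢ b′ →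
          adj G a b ≡ true → adj G a b′ ≡ true → adj G a′ b ≡ true → adj G a′ b′ ≡ true → a ≡ a′
        lin {a} {a′} a∈ a′∈ b∈ b′∈ b≢b′ ab ab′ a′b a′b′ with E⁻ b∈ | E⁻ b′∈
        ... | x , i , x∈ , i∈ , refl | y , j , y∈ , j∈ , refl = cases (∈-AllPairs₂ keys i∈ j∈)
          where
          at : ∀ {z a h} → z ∈ D → a ∈ D → adj G a (τ z h) ≡ true → τ z h ≡ τ a h
          at {h = h} z∈ a∈ = τ-unique (D⊆A′ a∈) h (τ∈ (D⊆A′ z∈) h)

          agree : ∀ {z h} → z ∈ D → adj G a (τ z h) ≡ true → adj G a′ (τ z h) ≡ true → τ a h ≡ τ a′ h
          agree z∈ e e′ = trans (≡-sym (at z∈ a∈ e)) (at z∈ a′∈ e′)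

          agreeR : a ∼⟨ R ⟩ a′
          agreeR = ∼-trans (∼-sym (class-∼ {f} {R} a∈)) (class-∼ {f} {R} a′∈)

          a∈F = class⊆F {f} {R} a∈
          a′∈F = class⊆F {f} {R} a′∈

          cases : i ≡ j ⊎ Key F (j ∷ i ∷ R) ⊎ Key F (i ∷ j ∷ R) → a ≡ a′
          -- Two distinct common neighbours cannot lie in one part, where each vertex of `D` has a
          -- single neighbour. In different parts they force agreement on `i`, `j` and `R`, a key;
          -- the two key cases reflect the order of `i` and `j` in `S`.
          cases (inj₁ refl)       = ⊥-elim (b≢b′ (trans (at x∈ a∈ ab) (≡-sym (at y∈ a∈ ab′))))
          cases (inj₂ (inj₁ key)) = key a∈F a′∈F (agree y∈ ab′ a′b′ ∷ agree x∈ ab a′b ∷ agreeR)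
          cases (inj₂ (inj₂ key)) = key a∈F a′∈F (agree x∈ ab a′b ∷ agree y∈ ab′ a′b′ ∷ agreeR)

    -- `K` is chosen to cancel the losses of sampling and homogenising, so that each part stays
    -- smaller than `F` and the greedy choice can start from rich singletons.
    ktt⊎girth₆ : 1 ≤ length A → K ≡ 2 * (N ^ k * loss t (length (words (allFin k) t))) →
                     HasKtt G t ⊎ DenseGirth₆Subgraph t
    ktt⊎girth₆ 1≤|A| K≡ = combine (nonempty-∈ 1≤|F|)
      where
      open ≤-Reasoning
      Is = words (allFin k) t
      Q = loss t (length Is)
      module H = Homogeneous (homogenise (length Is) Is A′ refl uniqueA′)
      open H using (F′⊑F; dich) renaming (F′ to F)

      |A|≤ : length A ≤ N ^ k * Q * length F
      |A|≤ = ≤-trans large (≤-trans (*-monoʳ-≤ (N ^ k) H.large) (≤-reflexive (≡-sym (*-assoc (N ^ k) Q _))))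

      1≤|F| : 1 ≤ length F
      1≤|F| = n≢0⇒n>0 λ |F|≡0 → <⇒≱ 1≤|A| (≤-trans |A|≤
        (≤-reflexive (trans (cong (N ^ k * Q *_) |F|≡0) (*-zeroʳ (N ^ k * Q)))))

      1≤NQ : 1 ≤ N ^ k * Q
      1≤NQ = n≢0⇒n>0 λ NQ≡0 → <⇒≱ 1≤|A| (≤-trans |A|≤ (≤-reflexive (cong (_* length F) NQ≡0)))

      2|X|≤|F| : ∀ i → 2 * length (X i) ≤ length F
      2|X|≤|F| i = *-cancelˡ-≤ (N ^ k * Q) {{>-nonZero 1≤NQ}} (begin
        N ^ k * Q * (2 * length (X i))  ≡⟨ lemma (N ^ k * Q) (length (X i)) ⟩
        2 * (N ^ k * Q) * length (X i)  ≡⟨ cong (_* length (X i)) (≡-sym K≡) ⟩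
        K * length (X i)                ≤⟨ small i ⟩
        N ^ k * length A′               ≤⟨ *-monoʳ-≤ (N ^ k) H.large ⟩
        N ^ k * (Q * length F)          ≡⟨ ≡-sym (*-assoc (N ^ k) Q _) ⟩
        N ^ k * Q * length F            ∎)
        where
        lemma : ∀ p x → p * (2 * x) ≡ 2 * p * x
        lemma = solve-∀

      -- The factor 2 in `K` makes the inequality strict, as `F` is nonempty.
      |X|<|F| : ∀ i → length (X i) < length F
      |X|<|F| i = ≰⇒> λ |F|≤|X| → <⇒≱ 1≤|F| (+-cancelˡ-≤ (length F) _ _ (begin
        length F + length F              ≡⟨ cong (length F +_) (≡-sym (+-identityʳ _)) ⟩
        2 * length F                     ≤⟨ *-monoʳ-≤ 2 |F|≤|X| ⟩
        2 * length (X i)                 ≤⟨ 2|X|≤|F| i ⟩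
        length F                         ≡⟨ ≡-sym (+-identityʳ _) ⟩
        length F + 0                     ∎))

      singletons : ∀ i → Rich F (i ∷ [])
      singletons i = fromDich (dich (∈-words {cs = allFin k} t {i ∷ []} (s≤s z≤n) ∈-allFin))
        where
        fromDich : Key F (i ∷ []) ⊎ Rich F (i ∷ []) → Rich F (i ∷ [])
        fromDich (inj₂ rich) = rich
        -- A key `i ∷ []` would embed `F` into the smaller `X i`.
        fromDich (inj₁ key)  = ⊥-elim (<⇒≱ (|X|<|F| i) (length-≤-inj (λ a → τ a i) (_⊑_.unique F′⊑F)
          (λ a∈ → τ∈ (_⊑_.subset F′⊑F a∈) i) (λ a∈ a′∈ eq → key a∈ a′∈ (eq ∷ []))))

      combine : ∃ (_∈ F) → HasKtt G t ⊎ DenseGirth₆Subgraph t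
      combine (f , f∈) = Sum.map
        (λ (J , |J| , uJ , richJ) → longRich⇒Ktt F′⊑F f∈ |J| uJ richJ)
        (flower⇒girth₆ F′⊑F f∈)
        (Coordinates.longRich⊎flower t (Key F) (Rich F)
          (λ {i} {I} |iI|≤t → dich (∈-words {cs = allFin k} t |iI|≤t ∈-allFin)) t₀ [] (allFin k) refl (allFin⁺ k)
          (≤-reflexive (≡-sym (length-tabulate {n = k} (λ i → i)))) (λ {i} _ → ([] ∷ []) , singletons i))

-- Choice of constants.

module _ (G : Graph) (col : Fin (n G) → Bool) (proper : ∀ u v → adj G u v ≡ true → col u ≢ col v) where
  open Degrees G
  open Transversals G

  -- Sampling with probability 1/(48ℓ) makes the upper degree bound 24ℓ exactly the permitted half.
  -- Of the lower bound 2ℓ, one ℓ serves as `s` and the other covers the `k` neighbours lost; then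
  -- `4 * suc r ≤ N * s` asks for N ≥ 4 · 48 = 192.
  sides⇒parts : ∀ {k N K ℓ} → .{{NonZero N}} → 192 ≤ N → 1 ≤ ℓ → k + N ^ k * K ≤ ℓ →
    (S : Sides col proper ℓ) → Parts k N K (Sides.A S) (Sides.B S)
  sides⇒parts {k} {N} {K} {ℓ} 192≤N 1≤ℓ ℓ-large S = parts k {pred (48 * ℓ)} {s = ℓ} uniqueA uniqueB
    (λ {a} a∈ → subst (2 * deg B a ≤_) q≡ (≤-trans (*-monoʳ-≤ 2 (upper a∈))
      (≤-reflexive (≡-sym (*-assoc 2 24 ℓ)))))
    (λ a∈ → ≤-trans (+-monoʳ-≤ ℓ (m+n≤o⇒m≤o k ℓ-large))
      (≤-trans (≤-reflexive (cong (ℓ +_) (≡-sym (+-identityʳ ℓ)))) (lower a∈)))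
    (subst (λ q → 4 * q ≤ N * ℓ) q≡ (≤-trans (≤-reflexive (≡-sym (*-assoc 4 48 ℓ))) (*-monoˡ-≤ ℓ 192≤N)))
    (subst (λ q → N ^ k * (K * length B) ≤ q * length A) q≡ (begin
      N ^ k * (K * length B)        ≡⟨ ≡-sym (*-assoc (N ^ k) K _) ⟩
      N ^ k * K * length B          ≤⟨ *-mono-≤ (m+n≤o⇒n≤o k ℓ-large) small ⟩
      ℓ * (4 * length A)            ≡⟨ lemma ℓ (length A) ⟩
      4 * ℓ * length A              ≤⟨ *-monoˡ-≤ (length A) (*-monoˡ-≤ ℓ (m≤m+n 4 44)) ⟩
      48 * ℓ * length A             ∎))
    where
    open Sides S
    open ≤-Reasoning
    q≡ : 48 * ℓ ≡ suc (pred (48 * ℓ))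
    q≡ = ≡-sym (suc-pred (48 * ℓ) {{>-nonZero (≤-trans 1≤ℓ (m≤n*m ℓ 48))}})
    lemma : ∀ ℓ a → ℓ * (4 * a) ≡ 4 * ℓ * a
    lemma = solve-∀

  dense⇒ktt⊎girth₆ : ∀ {t₀ N ℓ} →
    let k = enough (suc t₀) t₀
        K = 2 * (N ^ k * loss (suc t₀) (length (words (allFin k) (suc t₀)))) in
    .{{NonZero N}} → 192 ≤ N → 1 ≤ ℓ → k + N ^ k * K ≤ ℓ → AvgDegreeAtLeast G (4 * ℓ) →
    HasKtt G (suc t₀) ⊎ InducedSubgraph.DenseGirth₆Subgraph G col proper (suc t₀)
  dense⇒ktt⊎girth₆ {t₀} {N} {ℓ} 192≤N 1≤ℓ ℓ-large avg =
    Assembly.ktt⊎girth₆ G col proper colA colB (sides⇒parts 192≤N 1≤ℓ ℓ-large S) nonempty refl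
    where
    S = dense⇒sides col proper 1≤ℓ avg
    open Sides S

-- This is `4 * ℓ` for ℓ = `suc (k + N ^ k * K)`, the successor ensuring that ℓ is positive.
threshold : ℕ → ℕ → ℕ
threshold N zero     = 0
threshold N (suc t₀) = 4 * suc (k + N ^ k * K)
  where
  k = enough (suc t₀) t₀
  K = 2 * (N ^ k * loss (suc t₀) (length (words (allFin k) (suc t₀))))

aboveThreshold⇒ktt⊎girth₆ : ∀ N → .{{NonZero N}} → 192 ≤ N → ∀ t G (bip : Bipartite G) →
  AvgDegreeAtLeast G (threshold N t) →
  HasKtt G t ⊎ InducedSubgraph.DenseGirth₆Subgraph G (proj₁ bip) (proj₂ bip) t
aboveThreshold⇒ktt⊎girth₆ N 192≤N zero     G bip avg =
  -- For `t` = 0 the empty graph serves as the complete bipartite subgraph.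
  inj₁ ((λ ()) , (λ ()) , (λ { {()} }) , (λ { {()} }) , (λ ()) , λ ())
aboveThreshold⇒ktt⊎girth₆ N 192≤N (suc t₀) G bip avg =
  dense⇒ktt⊎girth₆ G (proj₁ bip) (proj₂ bip) 192≤N (s≤s z≤n) (n≤1+n _) avg

theorem1p1 : Σ (ℕ → ℕ) λ f → ∀ (t : ℕ) (G : Graph) → Bipartite G →
    AvgDegreeAtLeast G (f t) →
    HasKtt G t ⊎
    Σ ℕ λ m → Σ (Fin m → Fin (n G)) λ ι → Injective _≡_ _≡_ ι ×
    AvgDegreeAtLeast (induced G ι) t × GirthAtLeast (induced G ι) 6
theorem1p1 = threshold 192 , aboveThreshold⇒ktt⊎girth₆ 192 ≤-refl
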